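{- Let $n$ and $k$ be positive integers and consider $n$-vertex graphs $G$ with $\mathrm{VC}(G)=\omega(k\log n)$, where $\mathrm{VC}(G)$ is the minimum vertex cover size. There exists an $O(\log n)$-approximation randomized composable coreset of size $O(n\log n)$ for the minimum vertex cover problem. That is, there is an algorithm which, given a graph $H$ on the vertex set $V$, outputs a set of vertices $F(H)\subseteq V$ (a "fixed solution") and a subgraph $S(H)\subseteq H$ with $O(n\log n)$ edges, such that for any such $G$ and a random $k$-partitioning $G^{(1)},\dots,G^{(k)}$ of $G$: for any vertex cover $C$ of $S(G^{(1)})\cup\dots\cup S(G^{(k)})$, the set $C\cup\bigcup_{i}F(G^{(i)})$ is a vertex cover of $G$, and, with high probability over the partitioning, $\bigl|\bigcup_i F(G^{(i)})\bigr| + 2\,\mathrm{VC}\bigl(\bigcup_i S(G^{(i)})\bigr)= O(\log n)\cdot \mathrm{VC}(G)$ (so computing a $2$-approximate vertex cover of the union of the subgraphs and adding the fixed solutions yields an $O(\log n)$-approximate vertex cover of $G$).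
   Context: A random $k$-partitioning of the edge set $E$ of a graph $G(V,E)$ is obtained by assigning each edge independently to one of $k$ sets $E^{(1)},\dots,E^{(k)}$ uniformly at random; $G^{(i)}:=G(V,E^{(i)})$. A randomized composable coreset is here allowed to output, besides a subgraph, a set of vertices to be added directly to the final solution; its size counts the edges of the subgraph plus the vertices/edges of the fixed solution. Throughout, the paper assumes $\mathrm{VC}(G)=\omega(k\log n)$. -}

module Defs where

open import Data.Nat using (ℕ; zero; suc; _+_; _*_; _≤_; _⊓_; _≤ᵇ_)
open import Data.Nat.Logarithm using (⌊log₂_⌋)
open import Data.Bool using (Bool; true; false; _∧_; _∨_; not; if_then_else_)
open import Data.Fin using (Fin; toℕ; _≟_)
open import Data.Fin.Subset using (Subset; ⋃; ∣_∣; _∈_; _∪_; _⊆_)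
open import Data.List using (List; []; _∷_; map; concatMap; filter; length; lookup; foldr; allFin; sum)
open import Data.Vec using (Vec; []; _∷_; tabulate) renaming (lookup to vlookup)
open import Data.Product using (_×_; _,_; proj₁; proj₂)
open import Data.Sum using (_⊎_)
open import Relation.Nullary.Decidable using (⌊_⌋)
open import Data.Nat.Properties using (_<?_)

-- Potential edges of a simple graph on vertex set Fin n: unordered pairs,
-- listed as (i , j) with i < j.
pairs : (n : ℕ) → List (Fin n × Fin n)
pairs n = concatMap (λ j → map (λ i → (i , j)) (filter (λ i → toℕ i <? toℕ j) (allFin n))) (allFin n)

M : ℕ → ℕ
M n = length (pairs n)

-- A (simple, undirected) graph on Fin n: the set of its edges among the potential edges.
Graph : ℕ → Set
Graph n = Subset (M n)

edgeEnds : (n : ℕ) → Fin (M n) → Fin n × Fin n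
edgeEnds n e = lookup (pairs n) e

IsVertexCover : (n : ℕ) → Graph n → Subset n → Set
IsVertexCover n H C = ∀ (e : Fin (M n)) → e ∈ H → (proj₁ (edgeEnds n e) ∈ C) ⊎ (proj₂ (edgeEnds n e) ∈ C)

coversᵇ : (n : ℕ) → Graph n → Subset n → Bool
coversᵇ n H C = foldr _∧_ true
  (map (λ e → not (vlookup H e) ∨ vlookup C (proj₁ (edgeEnds n e)) ∨ vlookup C (proj₂ (edgeEnds n e))) (allFin (M n)))

allVecs : {X : Set} → List X → (m : ℕ) → List (Vec X m)
allVecs xs zero = [] ∷ []
allVecs xs (suc m) = concatMap (λ x → map (x ∷_) (allVecs xs m)) xs

allSubsets : (n : ℕ) → List (Subset n)
allSubsets n = allVecs (true ∷ false ∷ []) n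

-- VC(H): minimum size of a vertex cover of H (the full vertex set always covers, hence default n).
VC : (n : ℕ) → Graph n → ℕ
VC n H = foldr _⊓_ n (map ∣_∣ (filter (λ C → coversᵇ n H C Data.Bool.≟ true) (allSubsets n)))

edgeCount : {n : ℕ} → Graph n → ℕ
edgeCount H = ∣ H ∣

-- A random k-partitioning of the edges of G on Fin n is encoded by a colouring
-- c : Vec (Fin k) (M n) chosen uniformly at random (only colours of edges of G matter,
-- so the induced distribution on the partition of E(G) is the uniform one).
Colouring : ℕ → ℕ → Set
Colouring n k = Vec (Fin k) (M n)

allColourings : (n k : ℕ) → List (Colouring n k)
allColourings n k = allVecs (allFin k) (M n)

part : (n : ℕ) {k : ℕ} → Graph n → Colouring n k → Fin k → Graph n
part n G c i = tabulate (λ e → vlookup G e ∧ ⌊ vlookup c e ≟ i ⌋)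

record Coreset (n k : ℕ) : Set where
  field
    F : Graph n → Subset n
    S : Graph n → Graph n
open Coreset public

unionF : {n k : ℕ} → Coreset n k → Graph n → Colouring n k → Subset n
unionF {n} A G c = ⋃ (map (λ i → F A (part n G c i)) (allFin _))

unionS : {n k : ℕ} → Coreset n k → Graph n → Colouring n k → Graph n
unionS {n} A G c = ⋃ (map (λ i → S A (part n G c i)) (allFin _))

-- log n, rounded: 1 + ⌊log₂ n⌋ (≥ 1 so that O(log n) bounds are meaningful at n = 1).
lg : ℕ → ℕ
lg n = suc ⌊log₂ n ⌋

goodᵇ : {n k : ℕ} → Coreset n k → ℕ → Graph n → Colouring n k → Bool
goodᵇ {n} A C G c = (∣ unionF A G c ∣ + 2 * VC n (unionS A G c)) ≤ᵇ (C * lg n * VC n G)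

badCount : {n k : ℕ} → Coreset n k → ℕ → Graph n → ℕ
badCount {n} {k} A C G = length (filter (λ c → goodᵇ A C G c Data.Bool.≟ false) (allColourings n k))

module Submission where

-- Every part is peeled with thresholds lg n * 2 ^ j, j descending: the vertices
-- whose remaining degree reaches the threshold are removed.  The removed
-- vertices are the fixed solution, and the surviving ones have degree at most
-- lg n, so they span the residual subgraph.
--
-- For the approximation, fix a minimum cover C of G and peel G itself, with the
-- thresholds times k raised by a constant factor q on C and lowered by q off C.
-- By a Chernoff bound and a union bound all degrees in the parts fall on the
-- expected side of the thresholds except with probability n^(-d), for a q
-- depending on d only.  Then, level by level, every part peels at least as much
-- of C and at most as much of V ∖ C as this reference peeling does, so the union
-- of the fixed solutions lies in C together with the reference vertices outside
-- C.  Double counting the edges between C and the latter bounds their number by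
-- 2 q^2 |C| per level, and there are O(log n) levels.

open import Defs
open import Data.Bool using (Bool; true; false; _∧_; _∨_; not; if_then_else_; T)
open import Data.Fin using (Fin; zero; suc; _≟_; toℕ)
open import Data.Fin.Properties using (nonZeroIndex)
open import Data.Fin.Subset using (Subset; ∣_∣; _∈_; _∪_; _⊆_; ⋃; ⊤)
open import Data.Fin.Subset.Properties using (∣⊤∣≡n; ∈⊤; ∉⊥; x∈p∪q⁺; x∈p∪q⁻)
open import Data.List as List using (List; []; _∷_; map; concatMap; filter; length; foldr; allFin)
open import Data.List.Membership.Propositional using () renaming (_∈_ to _∈ˡ_)
open import Data.List.Membership.Propositional.Properties
  using (∈-map⁺; ∈-map∘filter⁺; ∈-map∘filter⁻; ∈-++⁺ˡ; ∈-++⁺ʳ; ∈-allFin; foldr-selective)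
open import Data.List.Properties using (length-map; length-filter; length-tabulate; length-++; filter-++)
open import Data.List.Relation.Unary.Any using (here; there)
open import Data.Nat hiding (_≟_)
open import Data.Nat.Logarithm using (⌊log₂⌋-mono-≤; ⌊log₂[2^n]⌋≡n)
open import Data.Nat.Properties hiding (_≟_)
open import Data.Nat.Tactic.RingSolver using (solve-∀)
open import Data.Product using (Σ; _×_; _,_; proj₁; proj₂; ∃)
open import Data.Sum using (_⊎_; inj₁; inj₂)
open import Data.Vec using (Vec; []; _∷_; lookup; tabulate)
open import Data.Vec.Properties using (lookup∘tabulate; []=⇒lookup; lookup⇒[]=)
open import Function using (_∘_; id)
open import Relation.Binary.PropositionalEquality
open import Relation.Nullary using (Dec; yes; no; ¬_; contradiction; does)
open import Relation.Nullary.Decidable using (⌊_⌋; isYes≗does)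
open import Relation.Unary using (Decidable)
open import Algebra.Properties.Semiring.Sum +-*-semiring
  using (sum; sum-cong-≗; ∑-distrib-+; ∑-comm; *-distribˡ-sum)

-- Booleans and their indicators

⟦_⟧ : Bool → ℕ
⟦ b ⟧ = if b then 1 else 0

⌊⌋-true : {P : Set} (P? : Dec P) → P → ⌊ P? ⌋ ≡ true
⌊⌋-true (yes _) _ = refl
⌊⌋-true (no ¬p) p = contradiction p ¬p

⌊⌋-false : {P : Set} (P? : Dec P) → ¬ P → ⌊ P? ⌋ ≡ false
⌊⌋-false (yes p) ¬p = contradiction p ¬p
⌊⌋-false (no _) _ = refl

true-⌊⌋ : {P : Set} (P? : Dec P) → ⌊ P? ⌋ ≡ true → P
true-⌊⌋ (yes p) _ = p

false-⌊⌋ : {P : Set} (P? : Dec P) → ⌊ P? ⌋ ≡ false → ¬ P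
false-⌊⌋ (no ¬p) _ = ¬p

∧-split : ∀ a {b} → a ∧ b ≡ true → a ≡ true × b ≡ true
∧-split true b = refl , b

∧-intro : ∀ {a b} → a ≡ true → b ≡ true → a ∧ b ≡ true
∧-intro refl refl = refl

∨-introˡ : ∀ {a b} → a ≡ true → a ∨ b ≡ true
∨-introˡ refl = refl

∨-introʳ : ∀ {a b} → b ≡ true → a ∨ b ≡ true
∨-introʳ {false} refl = refl
∨-introʳ {true} refl = refl

∨-split : ∀ a {b} → a ∨ b ≡ true → a ≡ true ⊎ b ≡ true
∨-split true _ = inj₁ refl
∨-split false b = inj₂ b

not-true : ∀ {a} → a ≡ false → not a ≡ true
not-true refl = refl

true-not : ∀ {a} → not a ≡ true → a ≡ false
true-not {false} _ = refl

≢true : ∀ {a} → (a ≡ true → a ≡ false) → a ≡ false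
≢true {false} _ = refl
≢true {true} f = f refl

⟦⟧≤0 : ∀ {a} → ⟦ a ⟧ ≤ 0 → a ≡ false
⟦⟧≤0 {false} _ = refl

⟦⟧-mono : ∀ {a b} → (a ≡ true → b ≡ true) → ⟦ a ⟧ ≤ ⟦ b ⟧
⟦⟧-mono {false} _ = z≤n
⟦⟧-mono {true} a⇒b rewrite a⇒b refl = ≤-refl

⟦⟧≤1 : ∀ b → ⟦ b ⟧ ≤ 1
⟦⟧≤1 false = z≤n
⟦⟧≤1 true = ≤-refl

⟦⟧-* : ∀ b {x y} → (b ≡ true → x ≤ y) → ⟦ b ⟧ * x ≤ y
⟦⟧-* false _ = z≤n
⟦⟧-* true {x} x≤y = ≤-trans (≤-reflexive (*-identityˡ x)) (x≤y refl)

-- Finite sums and cardinalities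

sum-mono : ∀ {n} {f g : Fin n → ℕ} → (∀ i → f i ≤ g i) → sum f ≤ sum g
sum-mono {zero} _ = z≤n
sum-mono {suc n} f≤g = +-mono-≤ (f≤g zero) (sum-mono (f≤g ∘ suc))

sum-const : ∀ n x → sum {n} (λ _ → x) ≡ n * x
sum-const zero x = refl
sum-const (suc n) x = cong (x +_) (sum-const n x)

sum≤const : ∀ {n x} {f : Fin n → ℕ} → (∀ i → f i ≤ x) → sum f ≤ n * x
sum≤const {n} {x} f≤x = ≤-trans (sum-mono f≤x) (≤-reflexive (sum-const n x))

term≤sum : ∀ {n} (f : Fin n → ℕ) i → f i ≤ sum f
term≤sum f zero = m≤m+n _ _
term≤sum f (suc i) = ≤-trans (term≤sum (f ∘ suc) i) (m≤n+m _ _)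

size : ∀ {n} → (Fin n → Bool) → ℕ
size P = sum (λ i → ⟦ P i ⟧)

size-mono : ∀ {n} {P Q : Fin n → Bool} → (∀ i → P i ≡ true → Q i ≡ true) → size P ≤ size Q
size-mono P⇒Q = sum-mono (λ i → ⟦⟧-mono (P⇒Q i))

size≤ : ∀ {n} (P : Fin n → Bool) → size P ≤ n
size≤ {n} P = ≤-trans (sum≤const (λ i → ⟦⟧≤1 (P i))) (≤-reflexive (*-identityʳ n))

size-⊎ : ∀ {n} {P Q S : Fin n → Bool} → (∀ i → P i ≡ true → Q i ≡ true ⊎ S i ≡ true) →
  size P ≤ size Q + size S
size-⊎ {P = P} {Q} {S} P⇒Q⊎S = begin
  size P                                ≤⟨ sum-mono (λ i → ⟦⟧≤ (P i) (P⇒Q⊎S i)) ⟩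
  sum (λ i → ⟦ Q i ⟧ + ⟦ S i ⟧)          ≡⟨ ∑-distrib-+ (λ i → ⟦ Q i ⟧) (λ i → ⟦ S i ⟧) ⟩
  size Q + size S                       ∎
  where
  open ≤-Reasoning
  ⟦⟧≤ : ∀ a {b c} → (a ≡ true → b ≡ true ⊎ c ≡ true) → ⟦ a ⟧ ≤ ⟦ b ⟧ + ⟦ c ⟧
  ⟦⟧≤ false _ = z≤n
  ⟦⟧≤ true f with f refl
  ... | inj₁ refl = s≤s z≤n
  ... | inj₂ refl = m≤n+m 1 _

⌊suc≟suc⌋ : ∀ {n} (i j : Fin n) → ⌊ suc i ≟ suc j ⌋ ≡ ⌊ i ≟ j ⌋
⌊suc≟suc⌋ i j = trans (isYes≗does (suc i ≟ suc j)) (sym (isYes≗does (i ≟ j)))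

sum-δ : ∀ {n} (i : Fin n) (h : Fin n → ℕ) b → sum (λ v → h v * ⟦ ⌊ i ≟ v ⌋ ∧ b ⟧) ≡ h i * ⟦ b ⟧
sum-δ {suc n} zero h b = begin
  h zero * ⟦ b ⟧ + sum (λ v → h (suc v) * 0)
    ≡⟨ cong (h zero * ⟦ b ⟧ +_) (trans (sum-cong-≗ (λ v → *-zeroʳ (h (suc v)))) (trans (sum-const n 0) (*-zeroʳ n))) ⟩
  h zero * ⟦ b ⟧ + 0  ≡⟨ +-identityʳ _ ⟩
  h zero * ⟦ b ⟧      ∎
  where open ≡-Reasoning
sum-δ {suc n} (suc i) h b = cong₂ _+_ (*-zeroʳ (h zero)) (trans
  (sum-cong-≗ (λ v → cong (λ t → h (suc v) * ⟦ t ∧ b ⟧) (⌊suc≟suc⌋ i v)))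
  (sum-δ i (h ∘ suc) b))

-- Double counting: the edges are grouped by their end `a e`. With `h` an indicator, this trades a
-- sum of degrees over a vertex set for a sum over edges.
sum-by-end : ∀ {m n} (a : Fin m → Fin n) (P : Fin m → Bool) (h : Fin n → ℕ) →
  sum (λ v → h v * size (λ e → ⌊ a e ≟ v ⌋ ∧ P e)) ≡ sum (λ e → h (a e) * ⟦ P e ⟧)
sum-by-end a P h = begin
  sum (λ v → h v * sum (λ e → ⟦ ⌊ a e ≟ v ⌋ ∧ P e ⟧))
    ≡⟨ sum-cong-≗ (λ v → *-distribˡ-sum (h v) (λ e → ⟦ ⌊ a e ≟ v ⌋ ∧ P e ⟧)) ⟩
  sum (λ v → sum (λ e → h v * ⟦ ⌊ a e ≟ v ⌋ ∧ P e ⟧))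
    ≡⟨ ∑-comm (λ v e → h v * ⟦ ⌊ a e ≟ v ⌋ ∧ P e ⟧) ⟩
  sum (λ e → sum (λ v → h v * ⟦ ⌊ a e ≟ v ⌋ ∧ P e ⟧))
    ≡⟨ sum-cong-≗ (λ e → sum-δ (a e) h (P e)) ⟩
  sum (λ e → h (a e) * ⟦ P e ⟧) ∎
  where open ≡-Reasoning

-- Counting colourings

-- This is `k ^ m` times the expectation over a uniform colouring; probabilities are handled as such
-- totals, without division. The recursion exposes one independent edge at a time.
total : ∀ {k m} → (Vec (Fin k) m → ℕ) → ℕ
total {m = zero} f = f []
total {m = suc m} f = sum (λ x → total (λ c → f (x ∷ c)))

total-mono : ∀ {k m} {f g : Vec (Fin k) m → ℕ} → (∀ c → f c ≤ g c) → total f ≤ total g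
total-mono {m = zero} f≤g = f≤g []
total-mono {m = suc m} f≤g = sum-mono (λ x → total-mono (λ c → f≤g (x ∷ c)))

total-*ˡ : ∀ {k m} a (f : Vec (Fin k) m → ℕ) → total (λ c → a * f c) ≡ a * total f
total-*ˡ {m = zero} a f = refl
total-*ˡ {m = suc m} a f = trans
  (sum-cong-≗ (λ x → total-*ˡ a (λ c → f (x ∷ c))))
  (sym (*-distribˡ-sum a (λ x → total (λ c → f (x ∷ c)))))

total-+ : ∀ {k m} (f g : Vec (Fin k) m → ℕ) → total (λ c → f c + g c) ≡ total f + total g
total-+ {m = zero} f g = refl
total-+ {m = suc m} f g = trans
  (sum-cong-≗ (λ x → total-+ (λ c → f (x ∷ c)) (λ c → g (x ∷ c))))
  (∑-distrib-+ (λ x → total (λ c → f (x ∷ c))) (λ x → total (λ c → g (x ∷ c))))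

total-0 : ∀ {k m} → total {k} {m} (λ _ → 0) ≡ 0
total-0 {k} {m} = total-*ˡ {k} {m} 0 (λ _ → 0)

total-sum : ∀ {k m n} (f : Fin n → Vec (Fin k) m → ℕ) →
  total (λ c → sum (λ i → f i c)) ≡ sum (λ i → total (f i))
total-sum {k} {m} {zero} f = total-0 {k} {m}
total-sum {n = suc n} f = trans
  (total-+ (f zero) (λ c → sum (λ i → f (suc i) c)))
  (cong (total (f zero) +_) (total-sum (f ∘ suc)))

-- The union bound, for events of total at most `B / N` each.
total-sum-bound : ∀ {k m n} (f : Fin n → Vec (Fin k) m → ℕ) {N B} →
  (∀ i → total (f i) * N ≤ B) → total (λ c → sum (λ i → f i c)) * N ≤ n * B
total-sum-bound {n = n} f {N} {B} bound = begin
  total (λ c → sum (λ i → f i c)) * N  ≡⟨ cong (_* N) (total-sum f) ⟩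
  sum (λ i → total (f i)) * N          ≡⟨ *-comm _ N ⟩
  N * sum (λ i → total (f i))          ≡⟨ *-distribˡ-sum N (λ i → total (f i)) ⟩
  sum (λ i → N * total (f i))          ≤⟨ sum≤const (λ i → ≤-trans (≤-reflexive (*-comm N _)) (bound i)) ⟩
  n * B                                ∎
  where open ≤-Reasoning

-- Exponential inequalities

*-^ : ∀ a b n → (a * b) ^ n ≡ a ^ n * b ^ n
*-^ a b zero = refl
*-^ a b (suc n) rewrite *-^ a b n = [m*n]*[o*p]≡[m*o]*[n*p] a b (a ^ n) (b ^ n)

^-cancelˡ-≤ : ∀ k .{{_ : NonZero k}} {x y} → x ^ k ≤ y ^ k → x ≤ y
^-cancelˡ-≤ k x≤y = ≮⇒≥ (λ y<x → <⇒≱ (^-monoˡ-< k y<x) x≤y)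

n<2^n : ∀ n → n < 2 ^ n
n<2^n zero = s≤s z≤n
n<2^n (suc n) = begin
  suc (suc n)      ≤⟨ s≤s (n<2^n n) ⟩
  1 + 2 ^ n        ≤⟨ +-mono-≤ (m^n>0 2 n) (≤-reflexive (sym (+-identityʳ _))) ⟩
  2 ^ n + (2 ^ n + 0) ∎
  where open ≤-Reasoning

-- Bernoulli's inequality (1 + 1/x)^j ≥ 1 + j/x, cleared of denominators.
bernoulli : ∀ x j → x ^ j * (x + j) ≤ suc x ^ j * x
bernoulli x zero = ≤-reflexive (cong (_+ 0) (+-identityʳ x))
bernoulli x (suc j) = begin
  x ^ suc j * (x + suc j)        ≡⟨ eq₁ x j (x ^ j) ⟩
  x ^ j * (x * (x + j) + x)      ≤⟨ *-monoʳ-≤ (x ^ j) (+-monoʳ-≤ (x * (x + j)) (m≤m+n x j)) ⟩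
  x ^ j * (x * (x + j) + (x + j)) ≡⟨ eq₂ x (x + j) (x ^ j) ⟩
  suc x * (x ^ j * (x + j))      ≤⟨ *-monoʳ-≤ (suc x) (bernoulli x j) ⟩
  suc x * (suc x ^ j * x)        ≡⟨ *-assoc (suc x) (suc x ^ j) x ⟨
  suc x ^ suc j * x              ∎
  where
  open ≤-Reasoning
  eq₁ : ∀ x j p → x * p * (x + suc j) ≡ p * (x * (x + j) + x)
  eq₁ = solve-∀
  eq₂ : ∀ x s p → p * (x * s + s) ≡ suc x * (p * s)
  eq₂ = solve-∀

-- (1 - 1/(x+1))^j ≥ 1 - j/(x+1), with r = x + 1 - j.
bernoulli⁻ : ∀ x j r → j + r ≡ suc x → suc x ^ j * r ≤ x ^ j * suc x
bernoulli⁻ x zero r eq = ≤-reflexive (cong (_+ 0) eq)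
bernoulli⁻ x (suc j) r eq = begin
  suc x * suc x ^ j * r       ≡⟨ eq₁ x r (suc x ^ j) ⟩
  suc x ^ j * (x * r + r)     ≤⟨ *-monoʳ-≤ (suc x ^ j) (+-monoʳ-≤ (x * r) r≤x) ⟩
  suc x ^ j * (x * r + x)     ≡⟨ eq₂ x r (suc x ^ j) ⟩
  x * (suc x ^ j * suc r)     ≤⟨ *-monoʳ-≤ x (bernoulli⁻ x j (suc r) (trans (+-suc j r) eq)) ⟩
  x * (x ^ j * suc x)         ≡⟨ *-assoc x (x ^ j) (suc x) ⟨
  x ^ suc j * suc x           ∎
  where
  open ≤-Reasoning
  r≤x : r ≤ x
  r≤x = ≤-trans (m≤n+m r j) (≤-reflexive (suc-injective eq))
  eq₁ : ∀ x r p → suc x * p * r ≡ p * (x * r + r)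
  eq₁ = solve-∀
  eq₂ : ∀ x r p → p * (x * r + x) ≡ x * (p * suc r)
  eq₂ = solve-∀

-- Here j is at most half of x + 1, so `bernoulli⁻` bounds (1 - 1/(x+1))^j below by 1/2; the claim
-- is the reciprocal.
suc^≤2* : ∀ x j r → j + r ≡ suc x → j ≤ r → suc x ^ j ≤ 2 * x ^ j
suc^≤2* x j zero eq j≤0 with z≤n ← j≤0 = contradiction eq λ ()
suc^≤2* x j r@(suc _) eq j≤r = *-cancelʳ-≤ _ _ r (begin
  suc x ^ j * r       ≤⟨ bernoulli⁻ x j r eq ⟩
  x ^ j * suc x       ≡⟨ cong (x ^ j *_) eq ⟨
  x ^ j * (j + r)     ≤⟨ *-monoʳ-≤ (x ^ j) (+-monoˡ-≤ r j≤r) ⟩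
  x ^ j * (r + r)     ≡⟨ eq₁ r (x ^ j) ⟩
  2 * x ^ j * r       ∎)
  where
  open ≤-Reasoning
  eq₁ : ∀ r p → p * (r + r) ≡ 2 * p * r
  eq₁ = solve-∀

-- The exponent is cut into two halves, each contributing a factor of at most 2. The constant 4
-- stands in for e from here on.
[1+1/k]^k≤4 : ∀ k → suc k ^ k ≤ 4 * k ^ k
[1+1/k]^k≤4 k = begin
  suc k ^ k                              ≡⟨ cong (suc k ^_) split ⟨
  suc k ^ (f + c)                        ≡⟨ ^-distribˡ-+-* (suc k) f c ⟩
  suc k ^ f * suc k ^ c                  ≤⟨ *-mono-≤
    (suc^≤2* k f (suc c) (trans (+-suc f c) (cong suc split)) (≤-trans f≤c (n≤1+n c)))
    (suc^≤2* k c (suc f) (trans (+-suc c f) (cong suc (trans (+-comm c f) split))) c≤1+f) ⟩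
  2 * k ^ f * (2 * k ^ c)                ≡⟨ eq (k ^ f) (k ^ c) ⟩
  4 * (k ^ f * k ^ c)                    ≡⟨ cong (4 *_) (^-distribˡ-+-* k f c) ⟨
  4 * k ^ (f + c)                        ≡⟨ cong (λ e → 4 * k ^ e) split ⟩
  4 * k ^ k                              ∎
  where
  open ≤-Reasoning
  f = ⌊ k /2⌋
  c = ⌈ k /2⌉
  split : f + c ≡ k
  split = ⌊n/2⌋+⌈n/2⌉≡n k
  f≤c : f ≤ c
  f≤c = ⌊n/2⌋-mono (n≤1+n k)
  c≤1+f : c ≤ suc f
  c≤1+f = ⌊n/2⌋-mono (n≤1+n (suc k))
  eq : ∀ p r → 2 * p * (2 * r) ≡ 4 * (p * r)
  eq = solve-∀

-- Induction on `z` by 1 + (z+1)/k ≤ (1 + z/k)(1 + 1/k).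
[1+z/k]^k≤4^z : ∀ k .{{_ : NonZero k}} z → (k + z) ^ k ≤ 4 ^ z * k ^ k
[1+z/k]^k≤4^z k zero = ≤-reflexive (trans (cong (_^ k) (+-identityʳ k)) (sym (*-identityˡ (k ^ k))))
[1+z/k]^k≤4^z k (suc z) = *-cancelʳ-≤ _ _ (k ^ k) {{m^n≢0 k k}} (begin
  (k + suc z) ^ k * k ^ k          ≡⟨ *-^ (k + suc z) k k ⟨
  ((k + suc z) * k) ^ k            ≤⟨ ^-monoˡ-≤ k (≤-trans (m≤m+n _ z) (≤-reflexive (eq₁ k z))) ⟩
  ((k + z) * suc k) ^ k            ≡⟨ *-^ (k + z) (suc k) k ⟩
  (k + z) ^ k * suc k ^ k          ≤⟨ *-mono-≤ ([1+z/k]^k≤4^z k z) ([1+1/k]^k≤4 k) ⟩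
  4 ^ z * k ^ k * (4 * k ^ k)      ≡⟨ eq₂ (4 ^ z) (k ^ k) ⟩
  4 ^ suc z * k ^ k * k ^ k        ∎)
  where
  open ≤-Reasoning
  eq₁ : ∀ k z → (k + suc z) * k + z ≡ (k + z) * suc k
  eq₁ = solve-∀
  eq₂ : ∀ p r → p * r * (4 * r) ≡ 4 * p * r * r
  eq₂ = solve-∀

-- The analogue of (1 + z/k)^D ≤ e^(zD/k). Since `k` need not divide `D`, the k-th powers of both
-- sides are compared.
[1+z/k]^D≤4^τ : ∀ k .{{_ : NonZero k}} z D τ → z * D ≤ k * τ → (k + z) ^ D ≤ 4 ^ τ * k ^ D
[1+z/k]^D≤4^τ k z D τ zD≤kτ = ^-cancelˡ-≤ k (begin
  ((k + z) ^ D) ^ k          ≡⟨ swap (k + z) D k ⟩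
  ((k + z) ^ k) ^ D          ≤⟨ ^-monoˡ-≤ D ([1+z/k]^k≤4^z k z) ⟩
  (4 ^ z * k ^ k) ^ D        ≡⟨ *-^ (4 ^ z) (k ^ k) D ⟩
  (4 ^ z) ^ D * (k ^ k) ^ D  ≡⟨ cong₂ _*_ (^-*-assoc 4 z D) (swap k k D) ⟩
  4 ^ (z * D) * (k ^ D) ^ k  ≤⟨ *-monoˡ-≤ ((k ^ D) ^ k) (^-monoʳ-≤ 4 zD≤kτ) ⟩
  4 ^ (k * τ) * (k ^ D) ^ k  ≡⟨ cong (λ e → 4 ^ e * (k ^ D) ^ k) (*-comm k τ) ⟩
  4 ^ (τ * k) * (k ^ D) ^ k  ≡⟨ cong (_* (k ^ D) ^ k) (^-*-assoc 4 τ k) ⟨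
  (4 ^ τ) ^ k * (k ^ D) ^ k  ≡⟨ *-^ (4 ^ τ) (k ^ D) k ⟨
  (4 ^ τ * k ^ D) ^ k        ∎)
  where
  open ≤-Reasoning
  swap : ∀ x a b → (x ^ a) ^ b ≡ (x ^ b) ^ a
  swap x a b = trans (^-*-assoc x a b) (trans (cong (x ^_) (*-comm a b)) (sym (^-*-assoc x b a)))

2*x^[1+x]≤ : ∀ x .{{_ : NonZero x}} → 2 * x ^ suc x ≤ suc x ^ suc x
2*x^[1+x]≤ x = *-cancelʳ-≤ _ _ x (begin
  2 * x ^ suc x * x            ≡⟨ eq x (x ^ suc x) ⟩
  x ^ suc x * (x + x)          ≤⟨ *-monoʳ-≤ (x ^ suc x) (+-monoʳ-≤ x (n≤1+n x)) ⟩
  x ^ suc x * (x + suc x)      ≤⟨ bernoulli x (suc x) ⟩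
  suc x ^ suc x * x            ∎)
  where
  open ≤-Reasoning
  eq : ∀ x p → 2 * p * x ≡ p * (x + x)
  eq = solve-∀

-- The exponent `D` contains `s` blocks of length x + 1. Over each block the power of x/(x+1) drops
-- to at most 1/2, and the remaining `r` factors are at most 1.
2^s*x^D≤ : ∀ x .{{_ : NonZero x}} s D → suc x * s ≤ D → 2 ^ s * x ^ D ≤ suc x ^ D
2^s*x^D≤ x s D xs≤D = begin
  2 ^ s * x ^ D                            ≡⟨ cong (λ e → 2 ^ s * x ^ e) (m+[n∸m]≡n xs≤D) ⟨
  2 ^ s * x ^ (suc x * s + r)              ≡⟨ cong (2 ^ s *_) (^-distribˡ-+-* x (suc x * s) r) ⟩
  2 ^ s * (x ^ (suc x * s) * x ^ r)        ≡⟨ *-assoc (2 ^ s) _ _ ⟨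
  2 ^ s * x ^ (suc x * s) * x ^ r          ≡⟨ cong (λ e → 2 ^ s * e * x ^ r) (^-*-assoc x (suc x) s) ⟨
  2 ^ s * (x ^ suc x) ^ s * x ^ r          ≡⟨ cong (_* x ^ r) (*-^ 2 (x ^ suc x) s) ⟨
  (2 * x ^ suc x) ^ s * x ^ r              ≤⟨ *-mono-≤ (^-monoˡ-≤ s (2*x^[1+x]≤ x)) (^-monoˡ-≤ r (n≤1+n x)) ⟩
  (suc x ^ suc x) ^ s * suc x ^ r          ≡⟨ cong (_* suc x ^ r) (^-*-assoc (suc x) (suc x) s) ⟩
  suc x ^ (suc x * s) * suc x ^ r          ≡⟨ ^-distribˡ-+-* (suc x) (suc x * s) r ⟨
  suc x ^ (suc x * s + r)                  ≡⟨ cong (suc x ^_) (m+[n∸m]≡n xs≤D) ⟩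
  suc x ^ D                                ∎
  where
  open ≤-Reasoning
  r = D ∸ suc x * s

-- Tail bounds for the number of edges of one colour

hits : ∀ {k m} → Fin k → (Fin m → Bool) → Vec (Fin k) m → ℕ
hits i D c = size (λ e → D e ∧ ⌊ lookup c e ≟ i ⌋)

factor : ∀ {k} → Fin k → ℕ → ℕ → Bool → Fin k → ℕ
factor i z y b x = if b then (if ⌊ x ≟ i ⌋ then z else y) else 1

-- Markov's inequality is applied to this product, an integral form of the moment
-- generating function of hits: its total over all colourings factors over edges.
weight : ∀ {k m} → Fin k → ℕ → ℕ → (Fin m → Bool) → Vec (Fin k) m → ℕ
weight i z y D [] = 1
weight i z y D (x ∷ c) = factor i z y (D zero) x * weight i z y (D ∘ suc) c

-- Edges of `D` with colour `i` contribute z and the others in `D` contribute y; the factor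
-- `y ^ hits i D c` avoids a subtraction in the exponent. Two bases are kept because the lower tail
-- takes the ratio z/y to be 1/2.
weight-hits : ∀ {k m} (i : Fin k) z y (D : Fin m → Bool) c →
  weight i z y D c * y ^ hits i D c ≡ z ^ hits i D c * y ^ size D
weight-hits i z y D [] = refl
weight-hits i z y D (x ∷ c) with weight-hits i z y (D ∘ suc) c | D zero | ⌊ x ≟ i ⌋
... | ih | false | _ = trans (cong (_* y ^ hits i (D ∘ suc) c) (*-identityˡ (weight i z y (D ∘ suc) c))) ih
... | ih | true | true = begin
  z * w * (y * Y)    ≡⟨ [m*n]*[o*p]≡[m*o]*[n*p] z w y Y ⟩
  z * y * (w * Y)    ≡⟨ cong (z * y *_) ih ⟩
  z * y * (Z * U)    ≡⟨ [m*n]*[o*p]≡[m*o]*[n*p] z y Z U ⟩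
  z * Z * (y * U)    ∎
  where
  open ≡-Reasoning
  w = weight i z y (D ∘ suc) c
  Y = y ^ hits i (D ∘ suc) c
  Z = z ^ hits i (D ∘ suc) c
  U = y ^ size (D ∘ suc)
... | ih | true | false = begin
  y * w * Y          ≡⟨ *-assoc y w Y ⟩
  y * (w * Y)        ≡⟨ cong (y *_) ih ⟩
  y * (Z * U)        ≡⟨ eq y Z U ⟩
  Z * (y * U)        ∎
  where
  open ≡-Reasoning
  w = weight i z y (D ∘ suc) c
  Y = y ^ hits i (D ∘ suc) c
  Z = z ^ hits i (D ∘ suc) c
  U = y ^ size (D ∘ suc)
  eq : ∀ y Z U → y * (Z * U) ≡ Z * (y * U)
  eq = solve-∀

sum-factor : ∀ {k} (i : Fin k) z y → sum (factor i z y true) + y ≡ k * y + z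
sum-factor {suc k} zero z y rewrite sum-const k y = eq z y (k * y)
  where
  eq : ∀ z y s → z + s + y ≡ y + s + z
  eq = solve-∀
sum-factor {suc k} (suc i) z y = begin
  y + sum (λ x → if ⌊ suc x ≟ suc i ⌋ then z else y) + y
    ≡⟨ cong (λ s → y + s + y) (sum-cong-≗ (λ x → cong (if_then z else y) (⌊suc≟suc⌋ x i))) ⟩
  y + sum (factor i z y true) + y    ≡⟨ +-assoc y _ y ⟩
  y + (sum (factor i z y true) + y)  ≡⟨ cong (y +_) (sum-factor i z y) ⟩
  y + (k * y + z)                    ≡⟨ +-assoc y (k * y) z ⟨
  y + k * y + z                      ∎
  where open ≡-Reasoning

-- Independence of the edges: one in `D` contributes the sum of `factor` over its colours, one
-- outside `D` contributes `k`.
total-weight : ∀ {k m} (i : Fin k) z y (D : Fin m → Bool) →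
  total (weight i z y D) * k ^ size D ≡ sum (factor i z y true) ^ size D * k ^ m
total-weight {m = zero} i z y D = refl
total-weight {k} {suc m} i z y D = begin
  sum (λ x → total (λ c → factor i z y (D zero) x * weight i z y (D ∘ suc) c)) * k ^ size D
    ≡⟨ cong (_* k ^ size D) (sum-cong-≗ (λ x → trans (total-*ˡ (factor i z y (D zero) x) (weight i z y (D ∘ suc))) (*-comm _ W))) ⟩
  sum (λ x → W * factor i z y (D zero) x) * k ^ size D
    ≡⟨ cong (_* k ^ size D) (*-distribˡ-sum W (factor i z y (D zero))) ⟨
  W * sum (factor i z y (D zero)) * k ^ size D
    ≡⟨ step (D zero) ⟩
  sum (factor i z y true) ^ size D * k ^ suc m ∎
  where
  open ≡-Reasoning
  s = sum (factor i z y true)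
  W = total (weight i z y (D ∘ suc))
  K = k ^ size (D ∘ suc)
  ih = total-weight i z y (D ∘ suc)
  eq₁ : ∀ W s k K → W * s * (k * K) ≡ s * k * (W * K)
  eq₁ = solve-∀
  eq₂ : ∀ s k U M → s * k * (U * M) ≡ s * U * (k * M)
  eq₂ = solve-∀
  eq₃ : ∀ W k K → W * (k * 1) * K ≡ k * (W * K)
  eq₃ = solve-∀
  eq₄ : ∀ k U M → k * (U * M) ≡ U * (k * M)
  eq₄ = solve-∀
  step : ∀ b → W * sum (factor i z y b) * k ^ (⟦ b ⟧ + size (D ∘ suc))
             ≡ s ^ (⟦ b ⟧ + size (D ∘ suc)) * k ^ suc m
  step true = trans (eq₁ W s k K) (trans (cong (s * k *_) ih) (eq₂ s k (s ^ size (D ∘ suc)) (k ^ m)))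
  step false = trans (cong (λ t → W * t * K) (sum-const k 1))
    (trans (eq₃ W k K) (trans (cong (k *_) ih) (eq₄ k (s ^ size (D ∘ suc)) (k ^ m))))

-- If a degree in the whole graph is off k τ by this factor, then the degree in
-- one part falls on the wrong side of τ with probability at most 2^(-bτ).
slack : ℕ → ℕ
slack b = 4 * 2 ^ b

-- Markov's inequality with base q = `slack b`: the probability is at most q^(-τ) (1 + q/k)^|D|, the
-- second factor is at most 4^τ by the hypothesis, and q = 4 * 2^b leaves 2^(-bτ).
upper-tail : ∀ {k m} (i : Fin k) b τ (D : Fin m → Bool) → slack b * size D ≤ k * τ →
  total (λ c → ⟦ ⌊ τ ≤? hits i D c ⌋ ⟧) * 2 ^ (b * τ) ≤ k ^ m
upper-tail {k} {m} i b τ D qD≤kτ = *-cancelʳ-≤ _ _ (4 ^ τ * K) {{m*n≢0 (4 ^ τ) K {{m^n≢0 4 τ}} {{m^n≢0 k (size D)}}}} (begin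
  P * 2 ^ (b * τ) * (4 ^ τ * K)      ≡⟨ eq₁ P (2 ^ (b * τ)) (4 ^ τ) K ⟩
  4 ^ τ * 2 ^ (b * τ) * P * K        ≡⟨ cong (λ e → 4 ^ τ * e * P * K) (^-*-assoc 2 b τ) ⟨
  4 ^ τ * (2 ^ b) ^ τ * P * K        ≡⟨ cong (λ e → e * P * K) (*-^ 4 (2 ^ b) τ) ⟨
  q ^ τ * P * K                      ≡⟨ cong (_* K) (total-*ˡ (q ^ τ) bad) ⟨
  total (λ c → q ^ τ * bad c) * K  ≤⟨ *-monoˡ-≤ K (total-mono markov) ⟩
  total (weight i q 1 D) * K         ≡⟨ total-weight i q 1 D ⟩
  sum (factor i q 1 true) ^ size D * k ^ m  ≤⟨ *-monoˡ-≤ (k ^ m) (^-monoˡ-≤ (size D) factor≤) ⟩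
  (k + q) ^ size D * k ^ m           ≤⟨ *-monoˡ-≤ (k ^ m) ([1+z/k]^D≤4^τ k q (size D) τ qD≤kτ) ⟩
  4 ^ τ * K * k ^ m                  ≡⟨ *-comm _ (k ^ m) ⟩
  k ^ m * (4 ^ τ * K)                ∎)
  where
  open ≤-Reasoning
  instance _ = nonZeroIndex i
  q = slack b
  K = k ^ size D
  bad : Vec (Fin _) m → ℕ
  bad c = ⟦ ⌊ τ ≤? hits i D c ⌋ ⟧
  P = total bad
  eq₁ : ∀ P B F K → P * B * (F * K) ≡ F * B * P * K
  eq₁ = solve-∀
  instance
    q≢0 : NonZero q
    q≢0 = m*n≢0 4 (2 ^ b) {{_}} {{m^n≢0 2 b}}
  weight≡ : ∀ c → weight i q 1 D c ≡ q ^ hits i D c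
  weight≡ c = begin-equality
    weight i q 1 D c                    ≡⟨ *-identityʳ _ ⟨
    weight i q 1 D c * 1                ≡⟨ cong (weight i q 1 D c *_) (^-zeroˡ (hits i D c)) ⟨
    weight i q 1 D c * 1 ^ hits i D c   ≡⟨ weight-hits i q 1 D c ⟩
    q ^ hits i D c * 1 ^ size D         ≡⟨ cong (q ^ hits i D c *_) (^-zeroˡ (size D)) ⟩
    q ^ hits i D c * 1                  ≡⟨ *-identityʳ _ ⟩
    q ^ hits i D c                      ∎
  markov : ∀ c → q ^ τ * ⟦ ⌊ τ ≤? hits i D c ⌋ ⟧ ≤ weight i q 1 D c
  markov c = ≤-trans (≤-reflexive (*-comm (q ^ τ) _)) (⟦⟧-* ⌊ τ ≤? hits i D c ⌋ λ t →
    ≤-trans (^-monoʳ-≤ q (true-⌊⌋ (τ ≤? hits i D c) t)) (≤-reflexive (sym (weight≡ c))))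
  factor≤ : sum (factor i q 1 true) ≤ k + q
  factor≤ = ≤-trans (m≤m+n _ 1) (≤-reflexive (trans (sum-factor i q 1) (cong (_+ q) (*-identityʳ k))))

-- Markov's inequality with base 1/2: the probability is at most 2^τ (1 - 1/(2k))^|D|. The
-- hypothesis makes the second factor at most 2^(-(b+1)τ), whose extra τ pays for 2^τ.
lower-tail : ∀ {k m} (i : Fin k) b τ (D : Fin m → Bool) → slack b * (k * τ) ≤ size D →
  total (λ c → ⟦ ⌊ hits i D c <? τ ⌋ ⟧) * 2 ^ (b * τ) ≤ k ^ m
lower-tail {k@(suc k-1)} {m} i b τ D qkτ≤D = *-cancelʳ-≤ _ _ (2 ^ τ * X) {{m*n≢0 (2 ^ τ) X {{m^n≢0 2 τ}} {{m^n≢0 x (size D)}}}} (begin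
  P * 2 ^ (b * τ) * (2 ^ τ * X)            ≡⟨ eq₁ P (2 ^ (b * τ)) (2 ^ τ) X ⟩
  P * (2 ^ τ * 2 ^ (b * τ) * X)            ≡⟨ cong (λ e → P * (e * X)) (^-distribˡ-+-* 2 τ (b * τ)) ⟨
  P * (2 ^ s * X)                          ≤⟨ *-monoʳ-≤ P (2^s*x^D≤ x s (size D) large) ⟩
  P * suc x ^ size D                       ≡⟨ cong (λ e → P * e ^ size D) (eq₂ k-1) ⟩
  P * (2 * k) ^ size D                     ≡⟨ cong (P *_) (*-^ 2 k (size D)) ⟩
  P * (2 ^ size D * K)                     ≡⟨ eq₃ P (2 ^ size D) K ⟩
  2 ^ size D * P * K                       ≡⟨ cong (_* K) (total-*ˡ (2 ^ size D) bad) ⟨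
  total (λ c → 2 ^ size D * bad c) * K  ≤⟨ *-monoˡ-≤ K (total-mono markov) ⟩
  total (λ c → 2 ^ τ * weight i 1 2 D c) * K  ≡⟨ cong (_* K) (total-*ˡ (2 ^ τ) (weight i 1 2 D)) ⟩
  2 ^ τ * total (weight i 1 2 D) * K       ≡⟨ *-assoc (2 ^ τ) _ K ⟩
  2 ^ τ * (total (weight i 1 2 D) * K)     ≡⟨ cong (2 ^ τ *_) (total-weight i 1 2 D) ⟩
  2 ^ τ * (sum (factor i 1 2 true) ^ size D * k ^ m)  ≡⟨ cong (λ e → 2 ^ τ * (e ^ size D * k ^ m)) factor≡ ⟩
  2 ^ τ * (X * k ^ m)                      ≡⟨ eq₄ (2 ^ τ) X (k ^ m) ⟩
  k ^ m * (2 ^ τ * X)                      ∎)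
  where
  open ≤-Reasoning
  -- This is 2k - 1, the sum of one weight 1 and k - 1 weights 2, so x/(x+1) is 1 - 1/(2k).
  x = suc (2 * k-1)
  X = x ^ size D
  K = k ^ size D
  s = suc b * τ
  bad : Vec (Fin k) m → ℕ
  bad c = ⟦ ⌊ hits i D c <? τ ⌋ ⟧
  P = total bad
  eq₁ : ∀ P B F X → P * B * (F * X) ≡ P * (F * B * X)
  eq₁ = solve-∀
  eq₂ : ∀ j → suc (suc (2 * j)) ≡ 2 * suc j
  eq₂ = solve-∀
  eq₃ : ∀ P S K → P * (S * K) ≡ S * P * K
  eq₃ = solve-∀
  eq₄ : ∀ F X M → F * (X * M) ≡ M * (F * X)
  eq₄ = solve-∀
  eq₅ : ∀ k b τ → 2 * k * (b * τ) ≡ 2 * b * (k * τ)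
  eq₅ = solve-∀
  eq₆ : ∀ j → suc j * 2 + 1 ≡ suc (2 * j) + 2
  eq₆ = solve-∀
  -- Since b < 2^b, `slack b` is at least 2(b + 1).
  large : suc x * s ≤ size D
  large = begin
    suc x * s                ≡⟨ cong (_* s) (eq₂ k-1) ⟩
    2 * k * (suc b * τ)      ≡⟨ eq₅ k (suc b) τ ⟩
    2 * suc b * (k * τ)      ≤⟨ *-monoˡ-≤ (k * τ) (*-mono-≤ {2} {4} (s≤s (s≤s z≤n)) (n<2^n b)) ⟩
    slack b * (k * τ)        ≤⟨ qkτ≤D ⟩
    size D                   ∎
  factor≡ : sum (factor i 1 2 true) ≡ x
  factor≡ = +-cancelʳ-≡ 2 _ _ (trans (sum-factor i 1 2) (eq₆ k-1))
  markov : ∀ c → 2 ^ size D * ⟦ ⌊ hits i D c <? τ ⌋ ⟧ ≤ 2 ^ τ * weight i 1 2 D c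
  markov c = ≤-trans (≤-reflexive (*-comm (2 ^ size D) _)) (⟦⟧-* ⌊ hits i D c <? τ ⌋ λ t → begin
    2 ^ size D                           ≡⟨ *-identityˡ _ ⟨
    1 * 2 ^ size D                       ≡⟨ cong (_* 2 ^ size D) (^-zeroˡ (hits i D c)) ⟨
    1 ^ hits i D c * 2 ^ size D          ≡⟨ weight-hits i 1 2 D c ⟨
    weight i 1 2 D c * 2 ^ hits i D c    ≡⟨ *-comm (weight i 1 2 D c) _ ⟩
    2 ^ hits i D c * weight i 1 2 D c    ≤⟨ *-monoˡ-≤ (weight i 1 2 D c) (^-monoʳ-≤ 2 (<⇒≤ (true-⌊⌋ (hits i D c <? τ) t))) ⟩
    2 ^ τ * weight i 1 2 D c             ∎)

-- Peeling

-- The test `heavy` is a parameter so that one recursion gives both the peeling of a part and the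
-- reference peeling. `R` holds the vertices not yet removed.
module Peel {n : ℕ} (L : ℕ) (heavy : ℕ → (Fin n → Bool) → Fin n → Bool) where

  next : ℕ → (Fin n → Bool) → Fin n → Bool
  next j R v = R v ∧ not (heavy (L * 2 ^ j) R v)

  peel : ℕ → (Fin n → Bool) → Fin n → Bool
  peel zero R = R
  peel (suc j) R = peel j (next j R)

-- Degrees into the remaining vertices

module Degrees {n m : ℕ} (end₁ end₂ : Fin m → Fin n) where

  deg : (Fin m → Bool) → (Fin n → Bool) → Fin n → ℕ
  deg h R v = size (λ e → (⌊ end₁ e ≟ v ⌋ ∧ (h e ∧ R (end₂ e))) ∨ (⌊ end₂ e ≟ v ⌋ ∧ (h e ∧ R (end₁ e))))

  deg-mono : ∀ h {R R′ : Fin n → Bool} v → (∀ u → R u ≡ true → R′ u ≡ true) → deg h R v ≤ deg h R′ v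
  deg-mono h {R} {R′} v R⇒R′ = size-mono (λ e t → widen e (∨-split (⌊ end₁ e ≟ v ⌋ ∧ _) t))
    where
    weaken : ∀ s e u → s ∧ (h e ∧ R u) ≡ true → s ∧ (h e ∧ R′ u) ≡ true
    weaken s e u t with ∧-split s t
    ... | s′ , t′ with ∧-split (h e) t′
    ... | he , Ru = ∧-intro s′ (∧-intro he (R⇒R′ u Ru))
    widen : ∀ e → ⌊ end₁ e ≟ v ⌋ ∧ (h e ∧ R (end₂ e)) ≡ true ⊎ ⌊ end₂ e ≟ v ⌋ ∧ (h e ∧ R (end₁ e)) ≡ true →
      (⌊ end₁ e ≟ v ⌋ ∧ (h e ∧ R′ (end₂ e))) ∨ (⌊ end₂ e ≟ v ⌋ ∧ (h e ∧ R′ (end₁ e))) ≡ true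
    widen e (inj₁ t) = ∨-introˡ (weaken ⌊ end₁ e ≟ v ⌋ e (end₂ e) t)
    widen e (inj₂ t) = ∨-introʳ {⌊ end₁ e ≟ v ⌋ ∧ _} (weaken ⌊ end₂ e ≟ v ⌋ e (end₁ e) t)

  heavyIn : (Fin m → Bool) → ℕ → (Fin n → Bool) → Fin n → Bool
  heavyIn h τ R v = ⌊ τ ≤? deg h R v ⌋

  module _ (L : ℕ) (h : Fin m → Bool) where
    open Peel L (heavyIn h)

    -- The hypothesis is the invariant of the recursion: vertices that pass the test at `L * 2 ^ j`
    -- have degree below it, and removals only lower degrees. At j = 0 it reads `L`.
    peel-deg : ∀ j R → (∀ v → R v ≡ true → deg h R v ≤ L * 2 ^ j) →
      ∀ v → peel j R v ≡ true → deg h (peel j R) v ≤ L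
    peel-deg zero R light v Rv = ≤-trans (light v Rv) (≤-reflexive (*-identityʳ L))
    peel-deg (suc j) R _ = peel-deg j (next j R) λ v R′v →
      ≤-trans (deg-mono h {next j R} {R} v (λ u → proj₁ ∘ ∧-split (R u)))
        (<⇒≤ (≰⇒> (false-⌊⌋ (L * 2 ^ j ≤? deg h R v) (true-not (proj₂ (∧-split (R v) R′v))))))

  -- Every residual edge is charged to its first end, and each vertex receives at most `d` charges.
  residual-size : ∀ h (R : Fin n → Bool) d → (∀ v → R v ≡ true → deg h R v ≤ d) →
    size (λ e → h e ∧ (R (end₁ e) ∧ R (end₂ e))) ≤ n * d
  residual-size h R d light = begin
    size (λ e → h e ∧ (R (end₁ e) ∧ R (end₂ e)))
      ≤⟨ sum-mono (λ e → split (h e) (R (end₁ e)) (R (end₂ e))) ⟩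
    sum (λ e → ⟦ R (end₁ e) ⟧ * ⟦ h e ∧ R (end₂ e) ⟧)
      ≡⟨ sum-by-end end₁ (λ e → h e ∧ R (end₂ e)) (λ v → ⟦ R v ⟧) ⟨
    sum (λ v → ⟦ R v ⟧ * size (λ e → ⌊ end₁ e ≟ v ⌋ ∧ (h e ∧ R (end₂ e))))
      ≤⟨ sum≤const (λ v → ⟦⟧-* (R v) λ Rv → ≤-trans (at-end₁ v) (light v Rv)) ⟩
    n * d ∎
    where
    open ≤-Reasoning
    at-end₁ : ∀ v → size (λ e → ⌊ end₁ e ≟ v ⌋ ∧ (h e ∧ R (end₂ e))) ≤ deg h R v
    at-end₁ v = size-mono {Q = λ e → (⌊ end₁ e ≟ v ⌋ ∧ (h e ∧ R (end₂ e))) ∨ (⌊ end₂ e ≟ v ⌋ ∧ (h e ∧ R (end₁ e)))}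
      λ e → ∨-introˡ
    split : ∀ a b c → ⟦ a ∧ (b ∧ c) ⟧ ≤ ⟦ b ⟧ * ⟦ a ∧ c ⟧
    split false b c = z≤n
    split true false c = z≤n
    split true true c = ≤-reflexive (sym (*-identityˡ ⟦ c ⟧))

  -- The peeling of the whole graph to which the peelings of the parts are
  -- compared: it counts only edges leaving the cover C, and its threshold is
  -- raised on C and lowered off C by the factor slack b.
  module Reference (k L b : ℕ) (g : Fin m → Bool) (C : Fin n → Bool)
    (cover : ∀ e → g e ≡ true → C (end₁ e) ≡ true ⊎ C (end₂ e) ≡ true) where

    q : ℕ
    q = slack b

    -- For an edge of `g` the inner end lies in the cover. An edge inside the cover has its outer
    -- end there too, and `cross` discards it.
    inner outer : Fin m → Fin n
    inner e = if C (end₁ e) then end₁ e else end₂ e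
    outer e = if C (end₁ e) then end₂ e else end₁ e

    cross : Fin m → Bool
    cross e = g e ∧ not (C (outer e))

    C-inner : ∀ e → g e ≡ true → C (inner e) ≡ true
    C-inner e ge with C (end₁ e) in eq₁ | cover e ge
    ... | true | _ = eq₁
    ... | false | inj₂ C₂ = C₂

    -- The Boolean says on which side of the cover `v` is taken to lie, hence which end of a
    -- crossing edge must be `v`.
    nbhd : Bool → (Fin n → Bool) → Fin n → Fin m → Bool
    nbhd true R v e = ⌊ inner e ≟ v ⌋ ∧ (cross e ∧ R (outer e))
    nbhd false R v e = ⌊ outer e ≟ v ⌋ ∧ (cross e ∧ R (inner e))

    -- The thresholds are q k τ on the cover and k τ / q off it. Being heavy in the first case and
    -- being light in the second are exactly the hypotheses of `lower-tail` and `upper-tail`.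
    heavyAt : Bool → ℕ → (Fin n → Bool) → Fin n → Bool
    heavyAt true τ R v = ⌊ q * (k * τ) ≤? size (nbhd true R v) ⌋
    heavyAt false τ R v = not ⌊ q * size (nbhd false R v) ≤? k * τ ⌋

    -- Only the harmful direction counts: a heavy vertex of the cover that looks light in part `i`,
    -- or a light vertex off the cover that looks heavy there.
    deviates : Bool → ℕ → (Fin n → Bool) → Fin n → Fin k → Vec (Fin k) m → Bool
    deviates true τ R v i c = heavyAt true τ R v ∧ ⌊ hits i (nbhd true R v) c <? τ ⌋
    deviates false τ R v i c = not (heavyAt false τ R v) ∧ ⌊ τ ≤? hits i (nbhd false R v) c ⌋

    open Peel L (λ τ R v → heavyAt (C v) τ R v) renaming (next to nextʳ; peel to peelʳ) public

    -- The sets `R` of the reference peeling do not depend on the colouring `c`. Each event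
    -- therefore concerns a fixed set of edges, and the tail bounds apply at every level without
    -- conditioning on earlier ones.
    deviations : ℕ → (Fin n → Bool) → Vec (Fin k) m → ℕ
    deviations zero R c = 0
    deviations (suc j) R c =
      sum (λ v → sum (λ i → ⟦ deviates (C v) (L * 2 ^ j) R v i c ⟧)) + deviations j (nextʳ j R) c

    total-∧ : ∀ a (P : Vec (Fin k) m → Bool) {N B} → (a ≡ true → total (λ c → ⟦ P c ⟧) * N ≤ B) →
      total (λ c → ⟦ a ∧ P c ⟧) * N ≤ B
    total-∧ true P bound = bound refl
    total-∧ false P {N} bound = ≤-trans (≤-reflexive (cong (_* N) (total-0 {k} {m}))) z≤n

    total-deviates : ∀ s τ R v i → total (λ c → ⟦ deviates s τ R v i c ⟧) * 2 ^ (b * τ) ≤ k ^ m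
    total-deviates true τ R v i = total-∧ (heavyAt true τ R v) (λ c → ⌊ hits i (nbhd true R v) c <? τ ⌋)
      λ heavy → lower-tail i b τ (nbhd true R v) (true-⌊⌋ (_ ≤? _) heavy)
    total-deviates false τ R v i = total-∧ (not (heavyAt false τ R v)) (λ c → ⌊ τ ≤? hits i (nbhd false R v) c ⌋)
      λ light → upper-tail i b τ (nbhd false R v) (true-⌊⌋ (_ ≤? _) (not-not light))
      where
      not-not : ∀ {a} → not (not a) ≡ true → a ≡ true
      not-not {true} _ = refl

    -- Union bound over `j` levels, `n` vertices and `k` colours. All thresholds are at least `L`,
    -- so each event has probability at most 2^(-bL).
    total-deviations : ∀ j R → total (deviations j R) * 2 ^ (b * L) ≤ j * (n * (k * k ^ m))
    total-deviations zero R = ≤-reflexive (cong (_* 2 ^ (b * L)) (total-0 {k} {m}))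
    total-deviations (suc j) R = begin
      total (deviations (suc j) R) * N
        ≡⟨ cong (_* N) (total-+ level (deviations j (nextʳ j R))) ⟩
      (total level + total (deviations j (nextʳ j R))) * N
        ≡⟨ *-distribʳ-+ N (total level) _ ⟩
      total level * N + total (deviations j (nextʳ j R)) * N
        ≤⟨ +-mono-≤
             (total-sum-bound (λ v c → sum (λ i → ⟦ deviates (C v) τ R v i c ⟧))
               (λ v → total-sum-bound (λ i c → ⟦ deviates (C v) τ R v i c ⟧) (single v)))
             (total-deviations j (nextʳ j R)) ⟩
      n * (k * k ^ m) + j * (n * (k * k ^ m)) ∎
      where
      open ≤-Reasoning
      N = 2 ^ (b * L)
      τ = L * 2 ^ j
      level : Vec (Fin k) m → ℕ
      level c = sum (λ v → sum (λ i → ⟦ deviates (C v) τ R v i c ⟧))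
      single : ∀ v i → total (λ c → ⟦ deviates (C v) τ R v i c ⟧) * N ≤ k ^ m
      single v i = ≤-trans
        (*-monoʳ-≤ (total (λ c → ⟦ deviates (C v) τ R v i c ⟧))
          (^-monoʳ-≤ 2 (*-monoʳ-≤ b (m≤m*n L (2 ^ j) {{m^n≢0 2 j}}))))
        (total-deviates (C v) τ R v i)

    -- Comparison of one part with the reference peeling

    module _ (c : Vec (Fin k) m) (i : Fin k) (h : Fin m → Bool)
      (h-part : ∀ e → h e ≡ g e ∧ ⌊ lookup c e ≟ i ⌋) where

      open Peel L (heavyIn h) using (next; peel)

      -- The edges counted on the left leave the cover, so the inclusion of `R` in `R′` is used only
      -- off the cover.
      hits≤deg : ∀ {R R′} v → (∀ u → C u ≡ false → R u ≡ true → R′ u ≡ true) →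
        hits i (nbhd true R v) c ≤ deg h R′ v
      hits≤deg {R} {R′} v R⇒R′ = size-mono pointwise
        where
        transfer : ∀ e w s → (s ∧ ((g e ∧ not (C w)) ∧ R w)) ∧ ⌊ lookup c e ≟ i ⌋ ≡ true → s ∧ (h e ∧ R′ w) ≡ true
        transfer e w s t with ∧-split (s ∧ ((g e ∧ not (C w)) ∧ R w)) t
        ... | t′ , col with ∧-split s t′
        ... | at-v , t″ with ∧-split (g e ∧ not (C w)) t″
        ... | crosses , Rw with ∧-split (g e) crosses
        ... | ge , outside = ∧-intro at-v
          (∧-intro (trans (h-part e) (∧-intro ge col)) (R⇒R′ w (true-not outside) Rw))
        pointwise : ∀ e → nbhd true R v e ∧ ⌊ lookup c e ≟ i ⌋ ≡ true →
          (⌊ end₁ e ≟ v ⌋ ∧ (h e ∧ R′ (end₂ e))) ∨ (⌊ end₂ e ≟ v ⌋ ∧ (h e ∧ R′ (end₁ e))) ≡ true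
        pointwise e t with C (end₁ e)
        ... | true = ∨-introˡ (transfer e (end₂ e) ⌊ end₁ e ≟ v ⌋ t)
        ... | false = ∨-introʳ {⌊ end₁ e ≟ v ⌋ ∧ _} (transfer e (end₁ e) ⌊ end₂ e ≟ v ⌋ t)

      -- A vertex off the cover has all its neighbours in the cover, so all its edges cross and only
      -- the remaining vertices of the cover matter.
      deg≤hits : ∀ {R R′} v → C v ≡ false → (∀ u → C u ≡ true → R′ u ≡ true → R u ≡ true) →
        deg h R′ v ≤ hits i (nbhd false R v) c
      deg≤hits {R} {R′} v Cv R′⇒R = size-mono λ e t → pointwise e (∨-split (⌊ end₁ e ≟ v ⌋ ∧ _) t)
        where
        pointwise : ∀ e →
          ⌊ end₁ e ≟ v ⌋ ∧ (h e ∧ R′ (end₂ e)) ≡ true ⊎ ⌊ end₂ e ≟ v ⌋ ∧ (h e ∧ R′ (end₁ e)) ≡ true →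
          nbhd false R v e ∧ ⌊ lookup c e ≟ i ⌋ ≡ true
        pointwise e (inj₁ t) with ∧-split ⌊ end₁ e ≟ v ⌋ t
        ... | at-v , t′ with ∧-split (h e) t′
        ... | hit , R′₂ with ∧-split (g e) (trans (sym (h-part e)) hit)
        ... | ge , col with trans (cong C (true-⌊⌋ (end₁ e ≟ v) at-v)) Cv | cover e ge
        ... | C₁ | inj₁ C₁′ with () ← trans (sym C₁) C₁′
        ... | C₁ | inj₂ C₂ rewrite C₁ =
          ∧-intro (∧-intro at-v (∧-intro (∧-intro ge (not-true C₁)) (R′⇒R _ C₂ R′₂))) col
        pointwise e (inj₂ t) with ∧-split ⌊ end₂ e ≟ v ⌋ t
        ... | at-v , t′ with ∧-split (h e) t′
        ... | hit , R′₁ with ∧-split (g e) (trans (sym (h-part e)) hit)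
        ... | ge , col with trans (cong C (true-⌊⌋ (end₂ e ≟ v) at-v)) Cv | cover e ge
        ... | C₂ | inj₂ C₂′ with () ← trans (sym C₂) C₂′
        ... | C₂ | inj₁ C₁ rewrite C₁ =
          ∧-intro (∧-intro at-v (∧-intro (∧-intro ge (not-true C₂)) (R′⇒R _ C₁ R′₁))) col

      -- The two inclusions sustain each other. More survivors off the cover raise the degrees on
      -- it, so the part removes every cover vertex that the reference removes; fewer survivors on
      -- the cover lower the degrees off it, so the part keeps every other vertex that the reference
      -- keeps.
      sandwich : ∀ j R R′ → deviations j R c ≤ 0 →
        (∀ v → C v ≡ true → R′ v ≡ true → R v ≡ true) →
        (∀ v → C v ≡ false → R v ≡ true → R′ v ≡ true) →
        ∀ v → C v ≡ false → peelʳ j R v ≡ true → peel j R′ v ≡ true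
      sandwich zero R R′ _ _ out = out
      sandwich (suc j) R R′ dev≤0 inn out = sandwich j (nextʳ j R) (next j R′)
        (≤-trans (m≤n+m _ _) dev≤0) inn′ out′
        where
        τ = L * 2 ^ j
        exact : ∀ v → deviates (C v) τ R v i c ≡ false
        exact v = ⟦⟧≤0 (begin
          ⟦ deviates (C v) τ R v i c ⟧
            ≤⟨ term≤sum (λ i → ⟦ deviates (C v) τ R v i c ⟧) i ⟩
          sum (λ i → ⟦ deviates (C v) τ R v i c ⟧)
            ≤⟨ term≤sum (λ v → sum (λ i → ⟦ deviates (C v) τ R v i c ⟧)) v ⟩
          sum (λ v → sum (λ i → ⟦ deviates (C v) τ R v i c ⟧))
            ≤⟨ m≤m+n _ _ ⟩
          deviations (suc j) R c
            ≤⟨ dev≤0 ⟩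
          0 ∎)
          where open ≤-Reasoning
        inn′ : ∀ v → C v ≡ true → next j R′ v ≡ true → nextʳ j R v ≡ true
        inn′ v Cv t with ∧-split (R′ v) t
        ... | R′v , light = ∧-intro (inn v Cv R′v) (not-true (subst (λ s → heavyAt s τ R v ≡ false) (sym Cv) (≢true λ heavy →
          contradiction
            (≤-trans
              (≮⇒≥ (false-⌊⌋ (hits i (nbhd true R v) c <? τ)
                (subst (λ a → a ∧ ⌊ hits i (nbhd true R v) c <? τ ⌋ ≡ false) heavy
                  (subst (λ s → deviates s τ R v i c ≡ false) Cv (exact v)))))
              (hits≤deg v out))
            (false-⌊⌋ (τ ≤? deg h R′ v) (true-not light)))))
        out′ : ∀ v → C v ≡ false → nextʳ j R v ≡ true → next j R′ v ≡ true
        out′ v Cv t with ∧-split (R v) t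
        ... | Rv , light = ∧-intro (out v Cv Rv) (not-true (⌊⌋-false (τ ≤? deg h R′ v) λ τ≤deg →
          false-⌊⌋ (τ ≤? hits i (nbhd false R v) c)
            (subst (λ a → a ∧ ⌊ τ ≤? hits i (nbhd false R v) c ⌋ ≡ false)
              (subst (λ s → not (heavyAt s τ R v) ≡ true) Cv light)
              (subst (λ s → deviates s τ R v i c ≡ false) Cv (exact v)))
            (≤-trans τ≤deg (deg≤hits v Cv inn))))

    -- Vertices removed outside the cover

    bounded : ℕ → (Fin n → Bool) → Set
    bounded j R = ∀ u → C u ≡ true → R u ≡ true → size (nbhd true R u) ≤ q * (k * (L * 2 ^ j))

    bounded-next : ∀ j R → bounded j (nextʳ j R)
    bounded-next j R u Cu t with ∧-split (R u) t
    ... | Ru , light = ≤-trans (size-mono weaken)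
      (<⇒≤ (≰⇒> (false-⌊⌋ (q * (k * (L * 2 ^ j)) ≤? size (nbhd true R u))
        (true-not (subst (λ s → not (heavyAt s (L * 2 ^ j) R u) ≡ true) Cu light)))))
      where
      weaken : ∀ e → nbhd true (nextʳ j R) u e ≡ true → nbhd true R u e ≡ true
      weaken e t with ∧-split ⌊ inner e ≟ u ⌋ t
      ... | at-u , t′ with ∧-split (cross e) t′
      ... | crosses , R′outer = ∧-intro at-u (∧-intro crosses (proj₁ (∧-split (R (outer e)) R′outer)))

    -- Each edge counted at a removed vertex outside C is counted at its end in
    -- C, where the previous threshold bounds the degree.
    removed-level : .{{_ : NonZero k}} .{{_ : NonZero L}} → ∀ j R → bounded (suc j) R →
      size (λ v → not (C v) ∧ (R v ∧ heavyAt false (L * 2 ^ j) R v)) ≤ 2 * (q * q) * size C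
    removed-level j R bounded-R = *-cancelʳ-≤ _ _ (k * τ) (begin
      size B * (k * τ)
        ≡⟨ *-comm (size B) (k * τ) ⟩
      k * τ * size B
        ≡⟨ *-distribˡ-sum (k * τ) (λ v → ⟦ B v ⟧) ⟩
      sum (λ v → k * τ * ⟦ B v ⟧)
        ≤⟨ sum-mono heavy-B ⟩
      sum (λ v → q * (⟦ B v ⟧ * size (nbhd false R v)))
        ≡⟨ *-distribˡ-sum q (λ v → ⟦ B v ⟧ * size (nbhd false R v)) ⟨
      q * sum (λ v → ⟦ B v ⟧ * size (nbhd false R v))
        ≡⟨ cong (q *_) (sum-by-end outer (λ e → cross e ∧ R (inner e)) (λ v → ⟦ B v ⟧)) ⟩
      q * sum (λ e → ⟦ B (outer e) ⟧ * ⟦ cross e ∧ R (inner e) ⟧)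
        ≤⟨ *-monoʳ-≤ q (sum-mono turn) ⟩
      q * sum (λ e → ⟦ C (inner e) ∧ R (inner e) ⟧ * ⟦ cross e ∧ R (outer e) ⟧)
        ≡⟨ cong (q *_) (sum-by-end inner (λ e → cross e ∧ R (outer e)) (λ v → ⟦ C v ∧ R v ⟧)) ⟨
      q * sum (λ v → ⟦ C v ∧ R v ⟧ * size (nbhd true R v))
        ≤⟨ *-monoʳ-≤ q (sum-mono light-C) ⟩
      q * sum (λ v → D * ⟦ C v ⟧)
        ≡⟨ cong (q *_) (*-distribˡ-sum D (λ v → ⟦ C v ⟧)) ⟨
      q * (D * size C)
        ≡⟨ eq q k L (2 ^ j) (size C) ⟩
      2 * (q * q) * size C * (k * τ) ∎)
      where
      open ≤-Reasoning
      τ = L * 2 ^ j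
      -- The bound left by the level before, on the cover side. Against the lowered threshold k τ /
      -- q it gives the ratio 2 q^2, with the 2 coming from the doubling of thresholds.
      D = q * (k * (L * 2 ^ suc j))
      instance
        2^j≢0 = m^n≢0 2 j
        τ≢0 = m*n≢0 L (2 ^ j)
        kτ≢0 = m*n≢0 k τ
      B : Fin n → Bool
      B v = not (C v) ∧ (R v ∧ heavyAt false τ R v)
      eq : ∀ q k L p s → q * (q * (k * (L * (2 * p))) * s) ≡ 2 * (q * q) * s * (k * (L * p))
      eq = solve-∀
      heavy-B : ∀ v → k * τ * ⟦ B v ⟧ ≤ q * (⟦ B v ⟧ * size (nbhd false R v))
      heavy-B v with B v in Bv
      ... | false = ≤-trans (≤-reflexive (*-zeroʳ (k * τ))) z≤n
      ... | true = begin
        k * τ * 1                           ≡⟨ *-identityʳ _ ⟩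
        k * τ                               ≤⟨ <⇒≤ (≰⇒> (false-⌊⌋ (q * size (nbhd false R v) ≤? k * τ)
                                                 (true-not (proj₂ (∧-split (R v) (proj₂ (∧-split (not (C v)) Bv))))))) ⟩
        q * size (nbhd false R v)           ≡⟨ cong (q *_) (*-identityˡ _) ⟨
        q * (1 * size (nbhd false R v))     ∎
      turn : ∀ e → ⟦ B (outer e) ⟧ * ⟦ cross e ∧ R (inner e) ⟧
                 ≤ ⟦ C (inner e) ∧ R (inner e) ⟧ * ⟦ cross e ∧ R (outer e) ⟧
      turn e = ⟦⟧-* (B (outer e)) λ Bo →
        ≤-trans (⟦⟧-mono {b = (C (inner e) ∧ R (inner e)) ∧ (cross e ∧ R (outer e))} λ t →
          let crosses , Ri = ∧-split (cross e) t in
          ∧-intro (∧-intro (C-inner e (proj₁ (∧-split (g e) crosses))) Ri)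
            (∧-intro crosses (proj₁ (∧-split (R (outer e)) (proj₂ (∧-split (not (C (outer e))) Bo))))))
        (≤-reflexive (⟦∧⟧ (C (inner e) ∧ R (inner e)) _))
        where
        ⟦∧⟧ : ∀ a b → ⟦ a ∧ b ⟧ ≡ ⟦ a ⟧ * ⟦ b ⟧
        ⟦∧⟧ false b = refl
        ⟦∧⟧ true b = sym (*-identityˡ ⟦ b ⟧)
      light-C : ∀ v → ⟦ C v ∧ R v ⟧ * size (nbhd true R v) ≤ D * ⟦ C v ⟧
      light-C v = ⟦⟧-* (C v ∧ R v) λ t → let Cv , Rv = ∧-split (C v) t in
        ≤-trans (bounded-R v Cv Rv) (≤-reflexive (trans (sym (*-identityʳ D)) (cong (λ s → D * ⟦ s ⟧) (sym Cv))))

    removed : .{{_ : NonZero k}} .{{_ : NonZero L}} → ∀ j R → bounded j R →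
      size (λ v → not (C v) ∧ (R v ∧ not (peelʳ j R v))) ≤ j * (2 * (q * q) * size C)
    removed zero R _ = ≤-trans (size-mono {Q = λ _ → false} λ v t → absurd (C v) (R v) t)
      (≤-reflexive (trans (sum-const n 0) (*-zeroʳ n)))
      where
      absurd : ∀ a b → not a ∧ (b ∧ not b) ≡ true → false ≡ true
      absurd false false ()
      absurd false true ()
      absurd true _ ()
    removed (suc j) R bounded-R = ≤-trans
      (size-⊎ (λ v → now-or-later (C v) (R v) (λ {s} → heavyAt s (L * 2 ^ j) R v) (peelʳ j (nextʳ j R) v)))
      (+-mono-≤ (removed-level j R bounded-R) (removed j (nextʳ j R) (bounded-next j R)))
      where
      -- `h` is abstracted over the side so that matching `a` with false identifies the test
      -- `heavyAt (C v)` of the peeling with the `heavyAt false` of `removed-level`.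
      now-or-later : ∀ a b (h : {Bool} → Bool) f → not a ∧ (b ∧ not f) ≡ true →
        not a ∧ (b ∧ h {false}) ≡ true ⊎ not a ∧ ((b ∧ not (h {a})) ∧ not f) ≡ true
      now-or-later false true h f t with h {false}
      ... | true = inj₁ refl
      ... | false = inj₂ t

-- Vertex covers and the coreset

∣p∣≡size : ∀ {n} (p : Subset n) → ∣ p ∣ ≡ size (lookup p)
∣p∣≡size [] = refl
∣p∣≡size (true ∷ p) = cong suc (∣p∣≡size p)
∣p∣≡size (false ∷ p) = ∣p∣≡size p

∣tabulate∣ : ∀ {n} (f : Fin n → Bool) → ∣ tabulate f ∣ ≡ size f
∣tabulate∣ f = trans (∣p∣≡size (tabulate f)) (sum-cong-≗ (λ i → cong ⟦_⟧ (lookup∘tabulate f i)))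

∈-tabulate : ∀ {n} (f : Fin n → Bool) {v} → f v ≡ true → v ∈ tabulate f
∈-tabulate f {v} fv = lookup⇒[]= v (tabulate f) (trans (lookup∘tabulate f v) fv)

tabulate-∈ : ∀ {n} (f : Fin n → Bool) {v} → v ∈ tabulate f → f v ≡ true
tabulate-∈ f {v} v∈ = trans (sym (lookup∘tabulate f v)) ([]=⇒lookup v∈)

module _ {X : Set} {n} (f : X → Subset n) {v : Fin n} where

  ∈-⋃⁺ : ∀ {x xs} → x ∈ˡ xs → v ∈ f x → v ∈ ⋃ (map f xs)
  ∈-⋃⁺ {xs = x ∷ xs} (here refl) v∈ = x∈p∪q⁺ (inj₁ v∈)
  ∈-⋃⁺ {xs = x ∷ xs} (there x∈) v∈ = x∈p∪q⁺ (inj₂ (∈-⋃⁺ x∈ v∈))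

  ∈-⋃⁻ : ∀ xs → v ∈ ⋃ (map f xs) → ∃ λ x → v ∈ f x
  ∈-⋃⁻ [] v∈ = contradiction v∈ ∉⊥
  ∈-⋃⁻ (x ∷ xs) v∈ with x∈p∪q⁻ (f x) (⋃ (map f xs)) v∈
  ... | inj₁ v∈x = x , v∈x
  ... | inj₂ v∈xs = ∈-⋃⁻ xs v∈xs

-- From enumerated colourings to totals

length-filter-map : ∀ {X Y : Set} {P : Y → Set} (P? : Decidable P) (f : X → Y) xs →
  length (filter P? (map f xs)) ≡ length (filter (P? ∘ f) xs)
length-filter-map P? f [] = refl
length-filter-map P? f (x ∷ xs) with does (P? (f x))
... | true = cong suc (length-filter-map P? f xs)
... | false = length-filter-map P? f xs

length-filter-concatMap : ∀ {k} {X Y : Set} {P : Y → Set} (P? : Decidable P) (f : X → List Y) (g : Fin k → X) →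
  length (filter P? (concatMap f (List.tabulate g))) ≡ sum (λ i → length (filter P? (f (g i))))
length-filter-concatMap {zero} P? f g = refl
length-filter-concatMap {suc k} P? f g = begin
  length (filter P? (f (g zero) List.++ rest))
    ≡⟨ cong length (filter-++ P? (f (g zero)) rest) ⟩
  length (filter P? (f (g zero)) List.++ filter P? rest)
    ≡⟨ length-++ (filter P? (f (g zero))) ⟩
  length (filter P? (f (g zero))) + length (filter P? rest)
    ≡⟨ cong (length (filter P? (f (g zero))) +_) (length-filter-concatMap P? f (g ∘ suc)) ⟩
  length (filter P? (f (g zero))) + sum (λ i → length (filter P? (f (g (suc i))))) ∎
  where
  open ≡-Reasoning
  rest = concatMap f (List.tabulate (g ∘ suc))

-- Links the list count in `badCount` to `total`: a function that is at least 1 on the counted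
-- colourings dominates their indicator.
count≤total : ∀ {k} m {P : Vec (Fin k) m → Set} (P? : Decidable P) (f : Vec (Fin k) m → ℕ) →
  (∀ c → P c → 1 ≤ f c) → length (filter P? (allVecs (allFin k) m)) ≤ total f
count≤total zero P? f P⇒1≤f with P? []
... | yes p = P⇒1≤f [] p
... | no _ = z≤n
count≤total {k} (suc m) P? f P⇒1≤f = begin
  length (filter P? (allVecs (allFin k) (suc m)))
    ≡⟨ length-filter-concatMap P? (λ x → map (x ∷_) (allVecs (allFin k) m)) id ⟩
  sum (λ x → length (filter P? (map (x ∷_) (allVecs (allFin k) m))))
    ≡⟨ sum-cong-≗ (λ x → length-filter-map P? (x ∷_) (allVecs (allFin k) m)) ⟩
  sum (λ x → length (filter (P? ∘ (x ∷_)) (allVecs (allFin k) m)))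
    ≤⟨ sum-mono (λ x → count≤total m (P? ∘ (x ∷_)) (f ∘ (x ∷_)) (λ c → P⇒1≤f (x ∷ c))) ⟩
  total f ∎
  where open ≤-Reasoning

-- Vertex covers and their minimum size

foldr-∧⁺ : ∀ {X : Set} (f : X → Bool) xs → (∀ x → f x ≡ true) → foldr _∧_ true (map f xs) ≡ true
foldr-∧⁺ f [] _ = refl
foldr-∧⁺ f (x ∷ xs) all = ∧-intro (all x) (foldr-∧⁺ f xs all)

foldr-∧⁻ : ∀ {X : Set} (f : X → Bool) {x xs} → x ∈ˡ xs → foldr _∧_ true (map f xs) ≡ true → f x ≡ true
foldr-∧⁻ f {xs = x ∷ xs} (here refl) t = proj₁ (∧-split (f x) t)
foldr-∧⁻ f {xs = x ∷ xs} (there x∈) t = foldr-∧⁻ f x∈ (proj₂ (∧-split (f x) t))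

foldr-⊓≤e : ∀ e xs → foldr _⊓_ e xs ≤ e
foldr-⊓≤e e [] = ≤-refl
foldr-⊓≤e e (x ∷ xs) = ≤-trans (m⊓n≤n x _) (foldr-⊓≤e e xs)

foldr-⊓≤∈ : ∀ e {x xs} → x ∈ˡ xs → foldr _⊓_ e xs ≤ x
foldr-⊓≤∈ e {xs = x ∷ xs} (here refl) = m⊓n≤m x _
foldr-⊓≤∈ e {xs = x ∷ xs} (there x∈) = ≤-trans (m⊓n≤n x _) (foldr-⊓≤∈ e x∈)

∈-allSubsets : ∀ {n} (p : Subset n) → p ∈ˡ allSubsets n
∈-allSubsets [] = here refl
∈-allSubsets {suc n} (true ∷ p) = ∈-++⁺ˡ (∈-map⁺ (true ∷_) (∈-allSubsets p))
∈-allSubsets {suc n} (false ∷ p) =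
  ∈-++⁺ʳ (map (true ∷_) (allSubsets n)) (∈-++⁺ˡ (∈-map⁺ (false ∷_) (∈-allSubsets p)))

module _ (n : ℕ) (H : Graph n) where

  covers⁺ : ∀ C → IsVertexCover n H C → coversᵇ n H C ≡ true
  covers⁺ C cover = foldr-∧⁺ _ (allFin (M n)) λ e → covered e
    where
    covered : ∀ e → not (lookup H e) ∨ lookup C (proj₁ (edgeEnds n e)) ∨ lookup C (proj₂ (edgeEnds n e)) ≡ true
    covered e with lookup H e in He
    ... | false = refl
    ... | true with cover e (lookup⇒[]= e H He)
    ... | inj₁ v∈ = ∨-introˡ ([]=⇒lookup v∈)
    ... | inj₂ v∈ = ∨-introʳ {lookup C (proj₁ (edgeEnds n e))} ([]=⇒lookup v∈)

  covers⁻ : ∀ C → coversᵇ n H C ≡ true → IsVertexCover n H C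
  covers⁻ C t e e∈H
    with ∨-split (not (lookup H e)) (foldr-∧⁻
      (λ e → not (lookup H e) ∨ lookup C (proj₁ (edgeEnds n e)) ∨ lookup C (proj₂ (edgeEnds n e))) (∈-allFin e) t)
  ... | inj₁ e∉H with () ← trans (sym ([]=⇒lookup e∈H)) (true-not e∉H)
  ... | inj₂ t′ with ∨-split (lookup C (proj₁ (edgeEnds n e))) t′
  ... | inj₁ v∈ = inj₁ (lookup⇒[]= _ C v∈)
  ... | inj₂ v∈ = inj₂ (lookup⇒[]= _ C v∈)

  private
    covering? : Decidable (λ C → coversᵇ n H C ≡ true)
    covering? C = coversᵇ n H C Data.Bool.≟ true

  VC≤ : ∀ C → IsVertexCover n H C → VC n H ≤ ∣ C ∣
  VC≤ C cover = foldr-⊓≤∈ n (∈-map∘filter⁺ ∣_∣ covering? (C , ∈-allSubsets C , refl , covers⁺ C cover))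

  VC≤n : VC n H ≤ n
  VC≤n = foldr-⊓≤e n (map ∣_∣ (filter covering? (allSubsets n)))

  -- A minimum over a list is one of its entries or the default `n`, and the full vertex set attains
  -- the default.
  minimum-cover : ∃ λ C → IsVertexCover n H C × ∣ C ∣ ≡ VC n H
  minimum-cover with foldr-selective ⊓-sel n (map ∣_∣ (filter covering? (allSubsets n)))
  ... | inj₁ VC≡n = ⊤ , (λ _ _ → inj₁ ∈⊤) , trans (∣⊤∣≡n n) (sym VC≡n)
  ... | inj₂ VC∈ with ∈-map∘filter⁻ ∣_∣ covering? {xs = allSubsets n} VC∈
  ... | C , _ , VC≡ , t = C , covers⁻ C t , sym VC≡

-- Number of potential edges and the top threshold

length-concatMap≤ : ∀ {X Y : Set} (f : X → List Y) b xs → (∀ x → length (f x) ≤ b) →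
  length (concatMap f xs) ≤ length xs * b
length-concatMap≤ f b [] _ = z≤n
length-concatMap≤ f b (x ∷ xs) f≤b = ≤-trans (≤-reflexive (length-++ (f x)))
  (+-mono-≤ (f≤b x) (length-concatMap≤ f b xs f≤b))

M≤n² : ∀ n → M n ≤ n * n
M≤n² n = ≤-trans (length-concatMap≤ row n (allFin n) row≤n) (≤-reflexive (cong (_* n) (length-tabulate {n = n} id)))
  where
  smaller : Fin n → List (Fin n)
  smaller j = filter (λ i → toℕ i <? toℕ j) (allFin n)
  row : Fin n → List (Fin n × Fin n)
  row j = map (λ i → i , j) (smaller j)
  row≤n : ∀ j → length (row j) ≤ n
  row≤n j = begin
    length (row j)      ≡⟨ length-map (λ i → i , j) (smaller j) ⟩
    length (smaller j)  ≤⟨ length-filter (λ i → toℕ i <? toℕ j) (allFin n) ⟩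
    length (allFin n)   ≡⟨ length-tabulate {n = n} id ⟩
    n                   ∎
    where open ≤-Reasoning

n<2^lg : ∀ n → n < 2 ^ lg n
n<2^lg n = ≰⇒> λ 2^lg≤n → 1+n≰n (≤-trans
  (≤-reflexive (sym (⌊log₂[2^n]⌋≡n (lg n)))) (⌊log₂⌋-mono-≤ 2^lg≤n))

-- This is why `2 * lg n` levels suffice: there are at most n^2 potential edges, so every degree
-- starts below the threshold that would precede the first level.
M≤top : ∀ n → M n ≤ lg n * 2 ^ (2 * lg n)
M≤top n = begin
  M n                        ≤⟨ M≤n² n ⟩
  n * n                      ≤⟨ *-mono-≤ (<⇒≤ (n<2^lg n)) (<⇒≤ (n<2^lg n)) ⟩
  2 ^ lg n * 2 ^ lg n        ≡⟨ cong (2 ^ lg n *_) (cong (2 ^_) (+-identityʳ (lg n))) ⟨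
  2 ^ lg n * 2 ^ (lg n + 0)  ≡⟨ ^-distribˡ-+-* 2 (lg n) (lg n + 0) ⟨
  2 ^ (2 * lg n)             ≤⟨ m≤n*m (2 ^ (2 * lg n)) (lg n) ⟩
  lg n * 2 ^ (2 * lg n)      ∎
  where open ≤-Reasoning

-- The peeling coreset: size and covering property

module _ (n : ℕ) where

  private
    end₁ end₂ : Fin (M n) → Fin n
    end₁ = proj₁ ∘ edgeEnds n
    end₂ = proj₂ ∘ edgeEnds n

    levels = 2 * lg n

    all : Fin n → Bool
    all _ = true

  open Degrees end₁ end₂

  survives : Graph n → Fin n → Bool
  survives H = Peel.peel (lg n) (heavyIn (lookup H)) levels all

  residual : Graph n → Fin (M n) → Bool
  residual H e = lookup H e ∧ (survives H (end₁ e) ∧ survives H (end₂ e))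

  peelingCoreset : ∀ k → Coreset n k
  peelingCoreset k = record
    { F = λ H → tabulate (not ∘ survives H)
    ; S = λ H → tabulate (residual H) }

  S⊆ : ∀ k H → S (peelingCoreset k) H ⊆ H
  S⊆ k H {e} e∈ = lookup⇒[]= e H (proj₁ (∧-split (lookup H e) (tabulate-∈ (residual H) e∈)))

  coreset-size : ∀ k H → ∣ F (peelingCoreset k) H ∣ + ∣ S (peelingCoreset k) H ∣ ≤ 2 * n * lg n
  coreset-size k H = begin
    ∣ F (peelingCoreset k) H ∣ + ∣ S (peelingCoreset k) H ∣
      ≡⟨ cong₂ _+_ (∣tabulate∣ (not ∘ survives H)) (∣tabulate∣ (residual H)) ⟩
    size (not ∘ survives H) + size (residual H)
      ≤⟨ +-mono-≤ (≤-trans (size≤ (not ∘ survives H)) (m≤m*n n (lg n)))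
           (residual-size (lookup H) (survives H) (lg n)
             (peel-deg (lg n) (lookup H) levels all λ v _ → ≤-trans (size≤ _) (M≤top n))) ⟩
    n * lg n + n * lg n
      ≡⟨ eq n (lg n) ⟩
    2 * n * lg n ∎
    where
    open ≤-Reasoning
    eq : ∀ n l → n * l + n * l ≡ 2 * n * l
    eq = solve-∀

  -- Consider an edge within the part of its own colour. Either one end was peeled there and is
  -- fixed, or both survive, the edge is residual and `C` covers it.
  union-covers : ∀ k G (c : Colouring n k) C → IsVertexCover n (unionS (peelingCoreset k) G c) C →
    IsVertexCover n G (C ∪ unionF (peelingCoreset k) G c)
  union-covers k G c C cover e e∈G = choose (survives H (end₁ e)) (survives H (end₂ e)) refl refl
    where
    i = lookup c e
    H = part n G c i
    peeled : ∀ {v} → survives H v ≡ false → v ∈ C ∪ unionF (peelingCoreset k) G c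
    peeled dead = x∈p∪q⁺ (inj₂ (∈-⋃⁺ (λ i → F (peelingCoreset k) (part n G c i)) (∈-allFin i)
      (∈-tabulate (not ∘ survives H) (not-true dead))))
    He : lookup H e ≡ true
    He = trans (lookup∘tabulate _ e) (∧-intro ([]=⇒lookup e∈G) (⌊⌋-true (i ≟ i) refl))
    choose : ∀ a b → survives H (end₁ e) ≡ a → survives H (end₂ e) ≡ b →
      end₁ e ∈ C ∪ unionF (peelingCoreset k) G c ⊎ end₂ e ∈ C ∪ unionF (peelingCoreset k) G c
    choose false _ dead _ = inj₁ (peeled dead)
    choose true false _ dead = inj₂ (peeled dead)
    choose true true alive₁ alive₂ with cover e (∈-⋃⁺ (λ i → S (peelingCoreset k) (part n G c i)) (∈-allFin i)
      (∈-tabulate (residual H) (∧-intro He (∧-intro alive₁ alive₂))))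
    ... | inj₁ v∈ = inj₁ (x∈p∪q⁺ (inj₁ v∈))
    ... | inj₂ v∈ = inj₂ (x∈p∪q⁺ (inj₁ v∈))

  -- Approximation factor and failure probability

  module Approximation (k b : ℕ) .{{_ : NonZero k}} (G : Graph n) where

    A : Coreset n k
    A = peelingCoreset k

    K : Subset n
    K = proj₁ (minimum-cover n G)

    K-cover : IsVertexCover n G K
    K-cover = proj₁ (proj₂ (minimum-cover n G))

    cover : ∀ e → lookup G e ≡ true → lookup K (end₁ e) ≡ true ⊎ lookup K (end₂ e) ≡ true
    cover e Ge with K-cover e (lookup⇒[]= e G Ge)
    ... | inj₁ v∈ = inj₁ ([]=⇒lookup v∈)
    ... | inj₂ v∈ = inj₂ ([]=⇒lookup v∈)

    open Reference k (lg n) b (lookup G) (lookup K) cover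

    -- Each of the `2 * lg n` levels costs 2 q^2 VC(G); the 3 collects one VC(G) for fixed vertices
    -- in the cover `K` and two for the residual union, which `K` covers as well.
    approx : ℕ
    approx = 4 * (q * q) + 3

    unionF-size : ∀ c → deviations levels all c ≤ 0 →
      ∣ unionF A G c ∣ ≤ VC n G + levels * (2 * (q * q) * VC n G)
    unionF-size c dev≤0 = begin
      ∣ unionF A G c ∣
        ≡⟨ ∣p∣≡size (unionF A G c) ⟩
      size (lookup (unionF A G c))
        ≤⟨ size-⊎ inside ⟩
      size (lookup K) + size (λ v → not (lookup K v) ∧ (true ∧ not (peelʳ levels all v)))
        ≤⟨ +-monoʳ-≤ (size (lookup K)) (removed levels all λ u _ _ → initially u) ⟩
      size (lookup K) + levels * (2 * (q * q) * size (lookup K))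
        ≡⟨ cong (λ s → s + levels * (2 * (q * q) * s))
             (trans (sym (∣p∣≡size K)) (proj₂ (proj₂ (minimum-cover n G)))) ⟩
      VC n G + levels * (2 * (q * q) * VC n G) ∎
      where
      open ≤-Reasoning
      initially : ∀ u → size (nbhd true all u) ≤ q * (k * (lg n * 2 ^ levels))
      initially u = ≤-trans (size≤ (nbhd true all u)) (≤-trans (M≤top n)
        (≤-trans (m≤n*m _ k) (m≤n*m _ q {{m*n≢0 4 (2 ^ b) {{_}} {{m^n≢0 2 b}}}})))
      inside : ∀ v → lookup (unionF A G c) v ≡ true →
        lookup K v ≡ true ⊎ not (lookup K v) ∧ (true ∧ not (peelʳ levels all v)) ≡ true
      inside v t with lookup K v in Kv | ∈-⋃⁻ (λ i → F A (part n G c i)) (allFin k) (lookup⇒[]= v _ t)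
      ... | true | _ = inj₁ refl
      -- Had `v` survived the reference peeling, `sandwich` would make it survive in part `i`, which
      -- fixed it.
      ... | false | i , v∈F = inj₂ (not-true (≢true λ survivesʳ → trans survivesʳ (trans
        (sym (sandwich c i (lookup (part n G c i)) (lookup∘tabulate _) levels all all dev≤0
          (λ _ _ _ → refl) (λ _ _ _ → refl) v Kv survivesʳ))
        (true-not (tabulate-∈ (not ∘ survives (part n G c i)) v∈F)))))

    VC-unionS : ∀ c → VC n (unionS A G c) ≤ VC n G
    VC-unionS c = ≤-trans (VC≤ n (unionS A G c) K covers) (≤-reflexive (proj₂ (proj₂ (minimum-cover n G))))
      where
      covers : IsVertexCover n (unionS A G c) K
      covers e e∈ with ∈-⋃⁻ (λ i → S A (part n G c i)) (allFin k) e∈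
      ... | i , e∈S = K-cover e (lookup⇒[]= e G (proj₁ (∧-split (lookup G e)
        (tabulate-∈ _ (S⊆ k (part n G c i) e∈S)))))

    good : ∀ c → deviations levels all c ≤ 0 →
      ∣ unionF A G c ∣ + 2 * VC n (unionS A G c) ≤ approx * lg n * VC n G
    good c dev≤0 = begin
      ∣ unionF A G c ∣ + 2 * VC n (unionS A G c)
        ≤⟨ +-mono-≤ (unionF-size c dev≤0) (*-monoʳ-≤ 2 (VC-unionS c)) ⟩
      v + levels * (2 * (q * q) * v) + 2 * v
        ≡⟨ eq₁ v l q ⟩
      3 * v + 4 * (q * q) * l * v
        ≤⟨ +-monoˡ-≤ (4 * (q * q) * l * v) (*-monoˡ-≤ v (m≤m*n 3 l)) ⟩
      3 * l * v + 4 * (q * q) * l * v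
        ≡⟨ eq₂ v l q ⟩
      approx * l * v ∎
      where
      open ≤-Reasoning
      v = VC n G
      l = lg n
      eq₁ : ∀ v l q → v + 2 * l * (2 * (q * q) * v) + 2 * v ≡ 3 * v + 4 * (q * q) * l * v
      eq₁ = solve-∀
      eq₂ : ∀ v l q → 3 * l * v + 4 * (q * q) * l * v ≡ (4 * (q * q) + 3) * l * v
      eq₂ = solve-∀

    -- By the contrapositive of `good`, a bad colouring has at least one deviation.
    badCount≤ : badCount A approx G * 2 ^ (b * lg n) ≤ levels * (n * (k * k ^ M n))
    badCount≤ = ≤-trans
      (*-monoˡ-≤ (2 ^ (b * lg n)) (count≤total (M n) (λ c → goodᵇ A approx G c Data.Bool.≟ false)
        (deviations levels all) λ c bad → ≰⇒> λ dev≤0 →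
          subst T bad (≤⇒≤ᵇ (good c dev≤0))))
      (total-deviations levels all)

    -- The 4 in b = d + 4 pays for the union bound in factors 2^(lg n), each exceeding n: two absorb
    -- the number of levels, one the vertices and one the colours, as k ≤ n. The other `d` give n^d.
    badCount-small : ∀ d → b ≡ d + 4 → n ≥ 1 → k ≤ n → badCount A approx G * n ^ d ≤ k ^ M n
    badCount-small d refl n≥1 k≤n = *-cancelʳ-≤ _ _ (levels * (n * k)) (begin
      β * n ^ d * (levels * (n * k))
        ≤⟨ *-monoʳ-≤ (β * n ^ d) (*-mono-≤ (<⇒≤ (n<2^n levels)) (*-mono-≤ n≤2^l (≤-trans k≤n n≤2^l))) ⟩
      β * n ^ d * (2 ^ levels * (2 ^ l * 2 ^ l))
        ≤⟨ *-monoˡ-≤ (2 ^ levels * (2 ^ l * 2 ^ l)) (*-monoʳ-≤ β (^-monoˡ-≤ d n≤2^l)) ⟩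
      β * (2 ^ l) ^ d * (2 ^ levels * (2 ^ l * 2 ^ l))
        ≡⟨ *-assoc β ((2 ^ l) ^ d) _ ⟩
      β * ((2 ^ l) ^ d * (2 ^ levels * (2 ^ l * 2 ^ l)))
        ≡⟨ cong (β *_) exponents ⟩
      β * 2 ^ (b * l)
        ≤⟨ badCount≤ ⟩
      levels * (n * (k * k ^ M n))
        ≡⟨ eq₁ levels n k (k ^ M n) ⟩
      k ^ M n * (levels * (n * k)) ∎)
      where
      open ≤-Reasoning
      instance
        n≢0 = >-nonZero n≥1
        nk≢0 = m*n≢0 n k
        lnk≢0 = m*n≢0 levels (n * k)
      l = lg n
      β = badCount A approx G
      n≤2^l : n ≤ 2 ^ l
      n≤2^l = <⇒≤ (n<2^lg n)
      eq₁ : ∀ l n k p → l * (n * (k * p)) ≡ p * (l * (n * k))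
      eq₁ = solve-∀
      eq₂ : ∀ l d → l * d + (2 * l + (l + l)) ≡ (d + 4) * l
      eq₂ = solve-∀
      exponents : (2 ^ l) ^ d * (2 ^ levels * (2 ^ l * 2 ^ l)) ≡ 2 ^ (b * l)
      exponents = begin-equality
        (2 ^ l) ^ d * (2 ^ levels * (2 ^ l * 2 ^ l))
          ≡⟨ cong₂ _*_ (^-*-assoc 2 l d) (trans (cong (2 ^ levels *_) (sym (^-distribˡ-+-* 2 l l)))
               (sym (^-distribˡ-+-* 2 levels (l + l)))) ⟩
        2 ^ (l * d) * 2 ^ (levels + (l + l))  ≡⟨ ^-distribˡ-+-* 2 (l * d) (levels + (l + l)) ⟨
        2 ^ (l * d + (levels + (l + l)))      ≡⟨ cong (2 ^_) (eq₂ l d) ⟩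
        2 ^ (b * l)                           ∎

theorem2 : Σ ℕ (λ Csize → Σ ((n k : ℕ) → Coreset n k) (λ A →
    ((n k : ℕ) → (H : Graph n) → (S (A n k) H ⊆ H)
    × (∣ F (A n k) H ∣ + ∣ S (A n k) H ∣ ≤ Csize * n * lg n))
    × ((n k : ℕ) → (G : Graph n) → (c : Colouring n k) → (C : Subset n)
    → IsVertexCover n (unionS (A n k) G c) C
    → IsVertexCover n G (C ∪ unionF (A n k) G c))
    × ((d : ℕ) → Σ ℕ (λ Capx → Σ ℕ (λ L →
    (n k : ℕ) → n ≥ 1 → k ≥ 1 → (G : Graph n) → VC n G ≥ L * k * lg n
    → badCount (A n k) Capx G * n ^ d ≤ k ^ M n)))))
theorem2 = 2 , peelingCoreset , (λ n k H → S⊆ n k H , coreset-size n k H) , union-covers , λ d →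
  4 * (slack (d + 4) * slack (d + 4)) + 3 , 1 , λ n k n≥1 k≥1 G VC≥ →
  Approximation.badCount-small n k (d + 4) {{>-nonZero k≥1}} G d refl n≥1
    -- With the constant 1, the lower bound on VC(G) gives k ≤ VC(G) ≤ n, as the union bound over
    -- colours requires.
    (≤-trans (m≤n*m k 1) (≤-trans (m≤m*n (1 * k) (lg n)) (≤-trans VC≥ (VC≤n n G))))
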